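{- Let $p\ge 0$ be a fixed integer, and let $\mathcal{F}$ be the set of all forbidden induced subgraphs for the class of $p$-edge-add chordal graphs that are not cycles. Then $\mathcal{F}$ is finite.
   Context: All graphs are simple, finite and undirected. A graph is chordal if it has no induced cycle of length greater than three. A graph $G$ is $p$-edge-add chordal if a chordal graph can be obtained from $G$ by adding at most $p$ non-edges (edges of the complement) of $G$. A forbidden induced subgraph for a hereditary class (closed under induced subgraphs) is a graph not in the class all of whose proper induced subgraphs are in the class. -}

module Defs where

open import Data.Nat using (ℕ; zero; suc; _+_; _≤_; _<_; _≡ᵇ_; _<ᵇ_)
open import Data.Nat.Properties using ()
open import Data.Bool using (Bool; true; false; _∧_; _∨_; not; if_then_else_)
open import Data.Fin using (Fin; toℕ)
open import Data.List using (List; map; allFin)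
open import Data.Nat.ListAction using (sum)
open import Data.Product using (Σ; ∃; _×_; _,_; Σ-syntax; ∃-syntax)
open import Relation.Binary.PropositionalEquality using (_≡_)
open import Relation.Nullary using (¬_)
open import Function.Definitions using (Injective; Bijective)

record Graph (n : ℕ) : Set where
  field
    adj   : Fin n → Fin n → Bool
    sym   : ∀ i j → adj i j ≡ adj j i
    irref : ∀ i → adj i i ≡ false
open Graph public

nextℕ : ℕ → ℕ → ℕ
nextℕ k a = if suc a ≡ᵇ k then 0 else suc a

cycAdj : (k : ℕ) → Fin k → Fin k → Bool
cycAdj k i j = (nextℕ k (toℕ i) ≡ᵇ toℕ j) ∨ (nextℕ k (toℕ j) ≡ᵇ toℕ i)

HasInducedCycle : ∀ {n} → Graph n → ℕ → Set
HasInducedCycle {n} G k =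
  Σ[ v ∈ (Fin k → Fin n) ] (Injective _≡_ _≡_ v × (∀ i j → adj G (v i) (v j) ≡ cycAdj k i j))

Chordal : ∀ {n} → Graph n → Set
Chordal G = ∀ k → 4 ≤ k → ¬ HasInducedCycle G k

addedCount : ∀ {n} → Graph n → Graph n → ℕ
addedCount {n} G H =
  sum (map (λ i → sum (map (λ j →
    if (toℕ i <ᵇ toℕ j) ∧ adj H i j ∧ not (adj G i j) then 1 else 0)
    (allFin n))) (allFin n))

EdgeAddChordal : ℕ → ∀ {n} → Graph n → Set
EdgeAddChordal p {n} G =
  Σ[ H ∈ Graph n ] ((∀ i j → adj G i j ≡ true → adj H i j ≡ true)
                   × addedCount G H ≤ p × Chordal H)

InducedSub : ∀ {m n} → Graph m → Graph n → Set
InducedSub {m} {n} H G =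
  Σ[ f ∈ (Fin m → Fin n) ] (Injective _≡_ _≡_ f × (∀ i j → adj H i j ≡ adj G (f i) (f j)))

Iso : ∀ {m n} → Graph m → Graph n → Set
Iso {m} {n} G H =
  Σ[ f ∈ (Fin m → Fin n) ] (Bijective _≡_ _≡_ f × (∀ i j → adj G i j ≡ adj H (f i) (f j)))

IsCycle : ∀ {n} → Graph n → Set
IsCycle {n} G =
  3 ≤ n × Σ[ σ ∈ (Fin n → Fin n) ] (Bijective _≡_ _≡_ σ × (∀ i j → adj G (σ i) (σ j) ≡ cycAdj n i j))

Forbidden : (∀ {n} → Graph n → Set) → ∀ {n} → Graph n → Set
Forbidden C {n} F =
  ¬ C F × (∀ {m} (H : Graph m) → m < n → InducedSub H F → C H)

{-# OPTIONS --safe #-}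

-- Call an induced cycle of length at least 4 a hole.  Suppose that F has many vertices, so that all
-- its small induced subgraphs are p-edge-add chordal and, F not being a cycle, F has no long hole.
-- We show by induction on p that F itself is p-edge-add chordal.  Choose a hole C (it is short).  If for
-- every chord uv of C the graph F + uv had a small induced subgraph that is not (p-1)-edge-add chordal,
-- the union of C and these subgraphs would be small and not p-edge-add chordal.  So the induction can
-- only fail because F + uv has a long hole D for some chord uv of C.  Cut D into many blocks.  A block
-- without neighbours on one of the two arcs of C between u and v would be part of a long hole of F; so
-- by the pigeonhole principle some x and y on different arcs both have neighbours in 2p + 2 common blocks.
-- Any two of these blocks give a hole through x and y, so any set of at most p edges whose addition
-- destroys all holes must include xy.  Hence the small induced subgraphs of F + xy are (p-1)-edge-add
-- chordal, and by induction F + xy must have a long hole.  Repeating the argument with x, y in place of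
-- u, v and the first and any other block in place of the arcs yields a forced new edge between these
-- two blocks, hence more than p forced edges in total.
module Submission where

open import Defs renaming (sym to adj-sym)
open import Data.Bool using (Bool; true; false; _∧_; not; if_then_else_) renaming (_≟_ to _≟ᵇ_; T to IsTrue)
open import Data.Empty using (⊥; ⊥-elim)
open import Data.Fin using (Fin; zero; suc; toℕ; fromℕ<; punchOut)
open import Data.Fin.Properties using (_≟_; any?; toℕ-injective; toℕ<n; toℕ-fromℕ<; injective⇒≤; punchOut-injective)
open import Data.List using (List; []; _∷_; _++_; length; map; upTo; take; concat; concatMap; filter; cartesianProduct; cartesianProductWith; allFin; lookup)
open import Data.List.Properties using (length-map; length-upTo; length-filter; length-deduplicate; filter-++; length-++; length-take)
open import Data.List.Membership.Propositional using (_∈_; _∉_; find; lose)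
open import Data.List.Membership.Propositional.Properties
open import Data.List.Membership.DecPropositional using () renaming (_∈?_ to mem?)
open import Data.List.Relation.Binary.Sublist.Propositional using (_⊆_; []; _∷_; _∷ʳ_; ⊆-trans)
open import Data.List.Relation.Binary.Sublist.Propositional.Properties using (All-resp-⊆; take-⊆)
open import Data.List.Relation.Unary.All as All using (All; []; _∷_)
import Data.List.Relation.Unary.All.Properties as All
open import Data.List.Relation.Unary.AllPairs as AllPairs using (AllPairs; []; _∷_)
import Data.List.Relation.Unary.AllPairs.Properties as AllPairs
open import Data.List.Relation.Unary.Any as Any using (Any; here; there)
import Data.List.Relation.Unary.Any.Properties as Any
open import Data.List.Relation.Unary.Unique.DecPropositional.Properties using (deduplicate-!)
open import Data.List.Relation.Unary.Unique.Propositional.Properties using (upTo⁺; allFin⁺; cartesianProduct⁺; filter⁺)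
open import Data.Nat using (ℕ; zero; suc; _+_; _*_; _∸_; _≤_; _<_; z≤n; s≤s; _≤?_; _≡ᵇ_; _<ᵇ_)
open import Data.Nat.ListAction using (sum)
open import Data.Nat.Properties hiding (_≟_)
open import Data.Product using (Σ; ∃; _×_; _,_; proj₁; proj₂; Σ-syntax; ∃-syntax)
open import Data.Sum using (_⊎_; inj₁; inj₂; [_,_]′; map₂)
open import Data.Unit using (⊤; tt)
open import Data.Vec as Vec using (Vec; []; _∷_)
open import Data.Vec.Properties using (lookup∘tabulate)
open import Function using (_∘_; mk⇔)
open import Function.Definitions using (Injective; Surjective)
open import Relation.Binary.Definitions using (tri<; tri≈; tri>)
open import Relation.Binary.PropositionalEquality using (_≡_; _≢_; refl; sym; trans; cong; cong₂; subst; subst₂; ≢-sym)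
open import Relation.Nullary using (¬_; Dec; yes; no; does)
open import Relation.Nullary.Decidable using (dec-true; does-⇔; _⊎-dec_; _×-dec_; ¬?)

-- Walks, induced paths and holes

Edge : ∀ {n} → Graph n → Fin n → Fin n → Set
Edge G x y = adj G x y ≡ true

edge? : ∀ {n} (G : Graph n) x y → Dec (Edge G x y)
edge? G x y = adj G x y ≟ᵇ true

edge-sym : ∀ {n} (G : Graph n) {x y} → Edge G x y → Edge G y x
edge-sym G e = trans (adj-sym G _ _) e

edge⇒≢ : ∀ {n} (G : Graph n) {x y} → Edge G x y → x ≢ y
edge⇒≢ G {x} e refl with () ← trans (sym e) (irref G x)

-- `X` restricts only the inner vertices; the two ends may lie outside it. A walk has at least one
-- edge and may repeat vertices.
data Walk {n} (G : Graph n) (X : Fin n → Set) : Fin n → Fin n → Set where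
  edge : ∀ {x y} → Edge G x y → Walk G X x y
  step : ∀ {x y z} → Edge G x z → X z → Walk G X z y → Walk G X x y

module _ {n} {G : Graph n} where

  walk-trans : ∀ {X x y z} → Walk G X x z → X z → Walk G X z y → Walk G X x y
  walk-trans (edge e)     Xz w = step e Xz w
  walk-trans (step e p v) Xz w = step e p (walk-trans v Xz w)

  walk-sym : ∀ {X x y} → Walk G X x y → Walk G X y x
  walk-sym (edge e)     = edge (edge-sym G e)
  walk-sym (step e p w) = walk-trans (walk-sym w) p (edge (edge-sym G e))

walk-map : ∀ {n} {G H : Graph n} {X Y : Fin n → Set} → (∀ {x y} → Edge G x y → Edge H x y) →
           (∀ {x} → X x → Y x) → ∀ {x y} → Walk G X x y → Walk H Y x y
walk-map f g (edge e)     = edge (f e)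
walk-map f g (step e p w) = step (f e) (g p) (walk-map f g w)

walk-along : ∀ {n} {G : Graph n} {X : Fin n → Set} (c : ℕ → Fin n) i r →
             (∀ t → i ≤ t → t ≤ i + r → Walk G X (c t) (c (suc t))) →
             (∀ t → i < t → t ≤ i + r → X (c t)) →
             Walk G X (c i) (c (suc (i + r)))
walk-along {G = G} {X} c i zero    ws ps =
  subst (λ j → Walk G X (c i) (c (suc j))) (sym (+-identityʳ i)) (ws i ≤-refl (m≤m+n i 0))
walk-along {G = G} {X} c i (suc r) ws ps =
  subst (λ j → Walk G X (c i) (c (suc j))) (sym (+-suc i r))
    (walk-trans (ws i ≤-refl (m≤m+n i _)) (ps (suc i) ≤-refl (subst (suc i ≤_) (sym (+-suc i r)) (s≤s (m≤m+n i r))))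
      (walk-along c (suc i) r
        (λ t a b → ws t (<⇒≤ a) (subst (t ≤_) (sym (+-suc i r)) b))
        (λ t a b → ps t (<⇒≤ a) (subst (t ≤_) (sym (+-suc i r)) b))))

-- The vertices are indexed by all of `ℕ`, so that dropping, shifting and joining paths is
-- arithmetic on indices; only `at 0`, ..., `at len` are meaningful.
record InducedPath {n} (G : Graph n) (X : Fin n → Set) (x y : Fin n) : Set where
  field
    len   : ℕ
    at    : ℕ → Fin n
    start : at 0 ≡ x
    end   : at len ≡ y
    inner : ∀ {i} → 0 < i → i < len → X (at i)
    next  : ∀ {i} → i < len → Edge G (at i) (at (suc i))
    non   : ∀ {i j} → suc i < j → j ≤ len → ¬ Edge G (at i) (at j)
    dis   : ∀ {i j} → i < j → j ≤ len → at i ≢ at j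

last≤ : ∀ {P : ℕ → Set} → (∀ i → Dec (P i)) → ∀ m →
        (∃[ j ] ∃[ r ] j + r ≡ m × P j × (∀ i → j < i → i ≤ m → ¬ P i)) ⊎ (∀ i → i ≤ m → ¬ P i)
last≤ P? m with P? m
... | yes Pm = inj₁ (m , 0 , +-identityʳ m , Pm , λ i m<i i≤m → ⊥-elim (<⇒≱ m<i i≤m))
last≤ P? zero | no ¬P0 = inj₂ λ { zero _ → ¬P0 }
last≤ P? (suc m) | no ¬Pm with last≤ P? m
... | inj₁ (j , r , eq , Pj , later) = inj₁ (j , suc r , trans (+-suc j r) (cong suc eq) , Pj , later′)
  where
  later′ : ∀ i → j < i → i ≤ suc m → ¬ _
  later′ i j<i i≤1+m with m≤n⇒m<n∨m≡n i≤1+m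
  ... | inj₁ (s≤s i≤m) = later i j<i i≤m
  ... | inj₂ refl      = ¬Pm
... | inj₂ none = inj₂ none′
  where
  none′ : ∀ i → i ≤ suc m → ¬ _
  none′ i i≤1+m with m≤n⇒m<n∨m≡n i≤1+m
  ... | inj₁ (s≤s i≤m) = none i i≤m
  ... | inj₂ refl      = ¬Pm

prepend : ∀ {A : Set} → A → (ℕ → A) → ℕ → A
prepend x f zero    = x
prepend x f (suc i) = f i

module _ {n} {G : Graph n} {X : Fin n → Set} where

  path-drop : ∀ {x y} (P : InducedPath G X x y) → let open InducedPath P in
              ∀ j r → j + r ≡ len → InducedPath G X (at j) y
  path-drop P j r eq = record
    { len   = r
    ; at    = λ i → at (j + i)
    ; start = cong at (+-identityʳ j)
    ; end   = trans (cong at eq) end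
    ; inner = λ {i} 0<i i<r → inner (<-≤-trans 0<i (m≤n+m i j)) (shift-< i<r)
    ; next  = λ {i} i<r → subst (λ h → Edge G (at (j + i)) (at h)) (sym (+-suc j i)) (next (shift-< i<r))
    ; non   = λ {i} {k} i<k k≤r → non (subst (_< j + k) (+-suc j i) (+-monoʳ-< j i<k)) (shift-≤ k≤r)
    ; dis   = λ i<k k≤r → dis (+-monoʳ-< j i<k) (shift-≤ k≤r)
    }
    where
    open InducedPath P
    shift-≤ : ∀ {i} → i ≤ r → j + i ≤ len
    shift-≤ {i} i≤r = subst (j + i ≤_) eq (+-monoʳ-≤ j i≤r)
    shift-< : ∀ {i} → i < r → j + i < len
    shift-< {i} i<r = subst (j + i <_) eq (+-monoʳ-< j i<r)

  -- Jumping from x to its last neighbour on the path keeps the path induced.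
  path-cons : ∀ {x z y} → Edge G x z → X z → InducedPath G X z y → InducedPath G X x y
  path-cons {x} {z} {y} e Xz P with last≤ (λ i → InducedPath.at P i ≟ x) (InducedPath.len P)
  -- If `x` already lies on the path, the tail starting there is the required path.
  ... | inj₁ (j , r , eq , at≡x , _) = subst (λ v → InducedPath G X v y) at≡x (path-drop P j r eq)
  ... | inj₂ ≢x with last≤ (λ i → edge? G x (InducedPath.at P i)) (InducedPath.len P)
  ...   | inj₂ none = ⊥-elim (none 0 z≤n (subst (Edge G x) (sym (InducedPath.start P)) e))
  ...   | inj₁ (j , r , eq , ej , later) = record
    { len   = suc r
    ; at    = prepend x (Q.at)
    ; start = refl
    ; end   = Q.end
    ; inner = λ { {suc i} _ (s≤s i<r) → inner′ (j + i) (subst (j + i <_) eq (+-monoʳ-< j i<r)) }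
    ; next  = λ { {zero} _ → subst (Edge G x) (sym Q.start) ej ; {suc i} (s≤s i<r) → Q.next i<r }
    ; non   = λ { {zero} {suc k} (s≤s 0<k) (s≤s k≤r) →
                    later (j + k) (m<m+n j 0<k) (subst (j + k ≤_) eq (+-monoʳ-≤ j k≤r))
                ; {suc i} {suc k} (s≤s i<k) (s≤s k≤r) → Q.non i<k k≤r }
    ; dis   = λ { {zero} {suc k} _ (s≤s k≤r) x≡ → ≢x (j + k) (subst (j + k ≤_) eq (+-monoʳ-≤ j k≤r)) (sym x≡)
                ; {suc i} {suc k} (s≤s i<k) (s≤s k≤r) → Q.dis i<k k≤r }
    }
    where
    open InducedPath P
    module Q = InducedPath (path-drop P j r eq)
    inner′ : ∀ i → i < len → X (at i)
    inner′ zero    _ = subst X (sym start) Xz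
    inner′ (suc i) l = inner (s≤s z≤n) l

  inducedPath : ∀ {x y} → Walk G X x y → InducedPath G X x y
  inducedPath {x} {y} (edge e) = record
    { len   = 1
    ; at    = prepend x (λ _ → y)
    ; start = refl
    ; end   = refl
    ; inner = λ { {suc i} _ (s≤s ()) }
    ; next  = λ { {zero} _ → e ; {suc i} (s≤s ()) }
    ; non   = λ { {i} {suc zero} (s≤s ()) _ ; {i} {suc (suc j)} _ (s≤s ()) }
    ; dis   = λ { {zero} {suc zero} _ _ → edge⇒≢ G e ; {suc i} {suc zero} (s≤s ()) _ ; {i} {suc (suc j)} _ (s≤s ()) }
    }
  inducedPath (step e p w) = path-cons e p (inducedPath w)

  path-long : ∀ {x y} → x ≢ y → ¬ Edge G x y → (P : InducedPath G X x y) → 2 ≤ InducedPath.len P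
  path-long {x} {y} x≢y x≁y P with InducedPath.len P | InducedPath.end P | InducedPath.next P
  ... | zero        | end | next = ⊥-elim (x≢y (trans (sym (InducedPath.start P)) end))
  ... | suc zero    | end | next = ⊥-elim (x≁y (subst₂ (Edge G) (InducedPath.start P) end (next (s≤s z≤n))))
  ... | suc (suc _) | _   | _    = s≤s (s≤s z≤n)

-- Only at 0, …, at (k ∸ 1) are meaningful; the last hypothesis of non excludes the edge joining these two.
record Hole {n} (G : Graph n) (k : ℕ) : Set where
  field
    at    : ℕ → Fin n
    4≤k   : 4 ≤ k
    dis   : ∀ {i j} → i < j → j < k → at i ≢ at j
    next  : ∀ {i} → suc i < k → Edge G (at i) (at (suc i))
    close : ∀ {i} → suc i ≡ k → Edge G (at 0) (at i)
    non   : ∀ {i j} → suc i < j → j < k → 0 < i ⊎ suc j < k → ¬ Edge G (at i) (at j)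

Apart : ∀ {n} → Graph n → (X Y : Fin n → Set) → Set
Apart G X Y = ∀ {a b} → X a → Y b → a ≢ b × ¬ Edge G a b

module _ {n} {G : Graph n} {X Y : Fin n → Set} (apart : Apart G X Y)
         {x y : Fin n} (x≢y : x ≢ y) (x≁y : ¬ Edge G x y)
         (P : InducedPath G X x y) (Q : InducedPath G Y y x) where
  private
    module P = InducedPath P
    module Q = InducedPath Q

    c : ℕ → Fin n
    c i with i ≤? P.len
    ... | yes _ = P.at i
    ... | no  _ = Q.at (i ∸ P.len)

    cP : ∀ {i} → i ≤ P.len → c i ≡ P.at i
    cP {i} i≤ with i ≤? P.len
    ... | yes _ = refl
    ... | no i≰ = ⊥-elim (i≰ i≤)

    cQ : ∀ i → c (P.len + i) ≡ Q.at i
    cQ zero = trans (cong c (+-identityʳ P.len)) (trans (cP ≤-refl) (trans P.end (sym Q.start)))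
    cQ (suc i) with P.len + suc i ≤? P.len
    ... | yes ≤P = ⊥-elim (m+1+n≰m P.len ≤P)
    ... | no _   = cong Q.at (m+n∸m≡n P.len (suc i))

    -- The vertex `y` belongs to both paths: `view` counts it as part of `Q`, `view′` as part of
    -- `P`.
    view : ∀ i → i < P.len ⊎ (∃[ r ] i ≡ P.len + r)
    view i with i <? P.len
    ... | yes i< = inj₁ i<
    ... | no i≮  = inj₂ (i ∸ P.len , sym (m+[n∸m]≡n (≮⇒≥ i≮)))

    view′ : ∀ i → i ≤ P.len ⊎ (∃[ r ] i ≡ P.len + suc r)
    view′ i with i ≤? P.len
    ... | yes i≤ = inj₁ i≤
    ... | no i≰ with m≤n⇒∃[o]m+o≡n (≰⇒> i≰)
    ...   | o , eq = inj₂ (o , trans (sym eq) (sym (+-suc P.len o)))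

    2≤P : 2 ≤ P.len
    2≤P = path-long x≢y x≁y P

    2≤Q : 2 ≤ Q.len
    2≤Q = path-long (≢-sym x≢y) (λ e → x≁y (edge-sym G e)) Q

    k : ℕ
    k = P.len + Q.len

    cQ≡ : ∀ i → Q.at i ≡ c (P.len + i)
    cQ≡ i = sym (cQ i)

    dis′ : ∀ {i j} → i < j → j < k → c i ≢ c j
    dis′ {i} {j} i<j j<k ci≡cj with view′ j
    ... | inj₁ j≤ = P.dis i<j j≤ (trans (sym (cP (≤-trans (<⇒≤ i<j) j≤))) (trans ci≡cj (cP j≤)))
    ... | inj₂ (r , refl) with view i
    ...   | inj₂ (s , refl) =
            Q.dis (+-cancelˡ-< P.len s (suc r) i<j) (<⇒≤ (+-cancelˡ-< P.len (suc r) Q.len j<k))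
              (trans (cQ≡ s) (trans ci≡cj (cQ (suc r))))
    ...   | inj₁ i<P with i
    -- Index 0 is `x`, which is also the last vertex of `Q`, so the comparison takes place within
    -- `Q`.
    ...     | zero  = Q.dis (+-cancelˡ-< P.len (suc r) Q.len j<k) ≤-refl
                        (trans (cQ≡ (suc r)) (trans (sym ci≡cj) (trans (cP z≤n) (trans P.start (sym Q.end)))))
    ...     | suc h = proj₁ (apart (P.inner (s≤s z≤n) i<P) (Q.inner (s≤s z≤n) (+-cancelˡ-< P.len (suc r) Q.len j<k)))
                        (trans (sym (cP (<⇒≤ i<P))) (trans ci≡cj (cQ (suc r))))

    next′ : ∀ {i} → suc i < k → Edge G (c i) (c (suc i))
    next′ {i} 1+i<k with view i
    ... | inj₁ i<P = subst₂ (Edge G) (sym (cP (<⇒≤ i<P))) (sym (cP i<P)) (P.next i<P)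
    ... | inj₂ (r , refl) = subst₂ (Edge G) (cQ≡ r) (trans (cQ≡ (suc r)) (cong c (+-suc P.len r)))
                              (Q.next (+-cancelˡ-< P.len r Q.len (<⇒≤ 1+i<k)))

    close′ : ∀ {i} → suc i ≡ k → Edge G (c 0) (c i)
    close′ {i} eq with view i
    ... | inj₁ i<P = ⊥-elim (<⇒≱ (m<m+n P.len (≤-trans (s≤s z≤n) 2≤Q)) (subst (_≤ P.len) eq i<P))
    ... | inj₂ (r , refl) with +-cancelˡ-≡ P.len (suc r) Q.len (trans (+-suc P.len r) eq)
    ...   | r+1≡ = subst₂ (Edge G) (trans (cong Q.at r+1≡) (trans Q.end (sym (trans (cP z≤n) P.start)))) (cQ≡ r)
                     (edge-sym G (Q.next (≤-reflexive r+1≡)))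

    non′ : ∀ {i j} → suc i < j → j < k → 0 < i ⊎ suc j < k → ¬ Edge G (c i) (c j)
    non′ {i} {j} i<j j<k ends e with view′ j
    ... | inj₁ j≤ = P.non i<j j≤ (subst₂ (Edge G) (cP (≤-trans (<⇒≤ (<⇒≤ i<j)) j≤)) (cP j≤) e)
    ... | inj₂ (r , refl) with view i
    ...   | inj₂ (s , refl) =
            Q.non (+-cancelˡ-< P.len (suc s) (suc r) (subst (_< P.len + suc r) (sym (+-suc P.len s)) i<j))
              (<⇒≤ (+-cancelˡ-< P.len (suc r) Q.len j<k))
              (subst₂ (Edge G) (cQ s) (cQ (suc r)) e)
    ...   | inj₁ i<P with i
    ...     | zero  = Q.non (+-cancelˡ-< P.len (suc (suc r)) Q.len (subst (_< k) (sym (+-suc P.len (suc r))) (1+j<k ends))) ≤-refl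
                        (edge-sym G (subst₂ (Edge G) (trans (cP z≤n) (trans P.start (sym Q.end))) (cQ (suc r)) e))
      where
      1+j<k : 0 < 0 ⊎ suc (P.len + suc r) < k → suc (P.len + suc r) < k
      1+j<k (inj₂ l) = l
    ...     | suc h = proj₂ (apart (P.inner (s≤s z≤n) i<P) (Q.inner (s≤s z≤n) (+-cancelˡ-< P.len (suc r) Q.len j<k)))
                        (subst₂ (Edge G) (cP (<⇒≤ i<P)) (cQ (suc r)) e)

  -- Each path has no chord of its own, and `apart` excludes chords between the two interiors. Since
  -- `x` and `y` are distinct and nonadjacent, each path has length at least 2, so the cycle has
  -- length at least 4.
  glue : Hole G (P.len + Q.len)
  glue = record
    { at = c ; 4≤k = +-mono-≤ 2≤P 2≤Q ; dis = dis′ ; next = next′ ; close = close′ ; non = non′ }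

  glue-inside : ∀ i → i < P.len + Q.len →
                let z = Hole.at glue i in z ≡ x ⊎ z ≡ y ⊎ X z ⊎ Y z
  glue-inside i i<k with view i
  ... | inj₂ (zero , refl)  = inj₂ (inj₁ (trans (cQ 0) Q.start))
  ... | inj₂ (suc r , refl) =
        inj₂ (inj₂ (inj₂ (subst Y (cQ≡ (suc r)) (Q.inner (s≤s z≤n) (+-cancelˡ-< P.len (suc r) Q.len i<k)))))
  ... | inj₁ i<P with i
  ...   | zero  = inj₁ (trans (cP z≤n) P.start)
  ...   | suc _ = inj₂ (inj₂ (inj₁ (subst X (sym (cP (<⇒≤ i<P))) (P.inner (s≤s z≤n) i<P))))

-- Graphs given by decidable relations, and the addition of one edge

module _ {n} {R : Fin n → Fin n → Set} (R? : ∀ x y → Dec (R x y))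
         (R-sym : ∀ {x y} → R x y → R y x) (R-irrefl : ∀ {x} → ¬ R x x) where

  private
    does⇒ : ∀ {A : Set} (a? : Dec A) → does a? ≡ true → A
    does⇒ (yes a) _ = a

  fromRel : Graph n
  fromRel = record
    { adj   = λ x y → does (R? x y)
    ; sym   = λ x y → does-⇔ (mk⇔ R-sym R-sym) (R? x y) (R? y x)
    ; irref = irr
    }
    where
    irr : ∀ x → does (R? x x) ≡ false
    irr x with R? x x
    ... | yes r = ⊥-elim (R-irrefl r)
    ... | no _  = refl

  fromRel⁺ : ∀ {x y} → R x y → Edge fromRel x y
  fromRel⁺ {x} {y} = dec-true (R? x y)

  fromRel⁻ : ∀ {x y} → Edge fromRel x y → R x y
  fromRel⁻ {x} {y} = does⇒ (R? x y)

-- The condition `x ≢ y` keeps the relation irreflexive even if `u ≡ v`, so `addEdge` is defined for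
-- all pairs.
AddRel : ∀ {n} → Graph n → (u v x y : Fin n) → Set
AddRel G u v x y = Edge G x y ⊎ (x ≢ y × (x ≡ u × y ≡ v ⊎ x ≡ v × y ≡ u))

module _ {n} (G : Graph n) (u v : Fin n) where
  private
    R? : ∀ x y → Dec (AddRel G u v x y)
    R? x y = edge? G x y ⊎-dec (¬? (x ≟ y) ×-dec ((x ≟ u ×-dec y ≟ v) ⊎-dec (x ≟ v ×-dec y ≟ u)))

    R-sym : ∀ {x y} → AddRel G u v x y → AddRel G u v y x
    R-sym (inj₁ e) = inj₁ (edge-sym G e)
    R-sym (inj₂ (x≢y , inj₁ (p , q))) = inj₂ (≢-sym x≢y , inj₂ (q , p))
    R-sym (inj₂ (x≢y , inj₂ (p , q))) = inj₂ (≢-sym x≢y , inj₁ (q , p))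

    R-irrefl : ∀ {x} → ¬ AddRel G u v x x
    R-irrefl (inj₁ e) = edge⇒≢ G e refl
    R-irrefl (inj₂ (x≢x , _)) = x≢x refl

  addEdge : Graph n
  addEdge = fromRel R? R-sym R-irrefl

  addEdge-⊇ : ∀ {x y} → Edge G x y → Edge addEdge x y
  addEdge-⊇ e = fromRel⁺ R? R-sym R-irrefl (inj₁ e)

  addEdge-new : u ≢ v → Edge addEdge u v
  addEdge-new u≢v = fromRel⁺ R? R-sym R-irrefl (inj₂ (u≢v , inj₁ (refl , refl)))

  addEdge⁻ : ∀ {x y} → Edge addEdge x y → Edge G x y ⊎ (x ≡ u × y ≡ v ⊎ x ≡ v × y ≡ u)
  addEdge⁻ e with fromRel⁻ R? R-sym R-irrefl e
  ... | inj₁ e′      = inj₁ e′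
  ... | inj₂ (_ , p) = inj₂ p

  addEdge⁻-off : ∀ {x y} → x ≢ u → x ≢ v → Edge addEdge x y → Edge G x y
  addEdge⁻-off x≢u x≢v e with addEdge⁻ e
  ... | inj₁ e′             = e′
  ... | inj₂ (inj₁ (p , _)) = ⊥-elim (x≢u p)
  ... | inj₂ (inj₂ (p , _)) = ⊥-elim (x≢v p)

-- Holes through a prescribed segment

module _ {n} {G : Graph n} (w : ℕ → Fin n) (m : ℕ) (2≤m : 2 ≤ m)
         (w-next : ∀ {i} → i < m → Edge G (w i) (w (suc i)))
         (w-non : ∀ {i j} → suc i < j → j ≤ m → ¬ Edge G (w i) (w j))
         (w-dis : ∀ {i j} → i < j → j ≤ m → w i ≢ w j)
         {Y : Fin n → Set} (w-apart : ∀ {i b} → 0 < i → i < m → Y b → w i ≢ b × ¬ Edge G (w i) b)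
         (rest : Walk G Y (w m) (w 0)) where
  private
    X : Fin n → Set
    X z = ∃[ i ] 0 < i × i < m × z ≡ w i

    along : ∀ m → 2 ≤ m → (∀ {i} → i < m → Edge G (w i) (w (suc i))) →
            Walk G (λ z → ∃[ i ] 0 < i × i < m × z ≡ w i) (w 0) (w m)
    along (suc m) _ next = walk-along w 0 m (λ t _ t≤m → edge (next (s≤s t≤m)))
                                            (λ t 0<t t≤m → t , 0<t , s≤s t≤m , refl)

    P : InducedPath G X (w 0) (w m)
    P = inducedPath (along m 2≤m w-next)

    module P = InducedPath P

    -- All vertices of `P` lie on the segment, and by `w-non` an edge cannot advance by more than
    -- one index. Hence `P` needs at least `m` steps to reach `w m`.
    slow : ∀ i → i ≤ P.len → ∃[ j ] j ≤ i × j ≤ m × P.at i ≡ w j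
    slow zero    _ = 0 , z≤n , z≤n , P.start
    slow (suc i) i<len with slow i (<⇒≤ i<len)
    ... | j , j≤i , j≤m , eq with where′
      where
      where′ : ∃[ j ] j ≤ m × P.at (suc i) ≡ w j
      where′ with m≤n⇒m<n∨m≡n i<len
      ... | inj₂ 1+i≡len = m , ≤-refl , trans (cong P.at 1+i≡len) P.end
      ... | inj₁ 1+i<len with P.inner (s≤s z≤n) 1+i<len
      ...   | j , _ , j<m , eq = j , <⇒≤ j<m , eq
    ...   | j′ , j′≤m , eq′ with j′ ≤? suc j
    ...     | yes j′≤1+j = j′ , ≤-trans j′≤1+j (s≤s j≤i) , j′≤m , eq′
    ...     | no j′≰1+j  = ⊥-elim (w-non (≰⇒> j′≰1+j) j′≤m (subst₂ (Edge G) eq eq′ (P.next i<len)))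

    m≤len : m ≤ P.len
    m≤len with slow P.len ≤-refl
    ... | j , j≤len , j≤m , eq with m≤n⇒m<n∨m≡n j≤m
    ...   | inj₁ j<m  = ⊥-elim (w-dis j<m ≤-refl (trans (sym eq) P.end))
    ...   | inj₂ refl = j≤len

    apart : Apart G X Y
    apart (i , 0<i , i<m , refl) Yb = w-apart 0<i i<m Yb

    w0≢wm : w 0 ≢ w m
    w0≢wm = w-dis (<⇒≤ 2≤m) ≤-refl

    w0≁wm : ¬ Edge G (w 0) (w m)
    w0≁wm = w-non 2≤m ≤-refl

    Q : InducedPath G Y (w m) (w 0)
    Q = inducedPath rest

  -- `P` contributes at least `m` edges, and `Q` at least two because its ends are distinct and
  -- nonadjacent.
  segment-hole : ∃[ k ] 2 + m ≤ k × Σ[ h ∈ Hole G k ]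
                   (∀ i → i < k → (∃[ j ] j ≤ m × Hole.at h i ≡ w j) ⊎ Y (Hole.at h i))
  segment-hole = P.len + InducedPath.len Q
    , subst (_≤ P.len + InducedPath.len Q) (+-comm m 2) (+-mono-≤ m≤len (path-long (≢-sym w0≢wm) (w0≁wm ∘ edge-sym G) Q))
    , glue {X = X} {Y} apart w0≢wm w0≁wm P Q
    , λ i i<k → place (glue-inside {X = X} {Y} apart w0≢wm w0≁wm P Q i i<k)
    where
    place : ∀ {z} → z ≡ w 0 ⊎ z ≡ w m ⊎ X z ⊎ Y z → (∃[ j ] j ≤ m × z ≡ w j) ⊎ Y z
    place (inj₁ eq)                               = inj₁ (0 , z≤n , eq)
    place (inj₂ (inj₁ eq))                        = inj₁ (m , ≤-refl , eq)
    place (inj₂ (inj₂ (inj₁ (i , _ , i<m , eq)))) = inj₁ (i , <⇒≤ i<m , eq)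
    place (inj₂ (inj₂ (inj₂ Yz)))                 = inj₂ Yz

hole-walk-up : ∀ {n} {G₀ G : Graph n} {Y k} (h : Hole G₀ k) → let open Hole h in
               (∀ {x y} → Edge G₀ x y → Walk G Y x y) → ∀ {i} → i < k →
               (∀ {j} → i < j → j < k → Y (at j)) → Walk G Y (at i) (at 0)
hole-walk-up {G₀ = G₀} h detour {i} i<k inY with m≤n⇒m<n∨m≡n i<k
... | inj₂ last = detour (edge-sym G₀ (Hole.close h last))
... | inj₁ 1+i<k with m≤n⇒∃[o]m+o≡n 1+i<k
...   | o , refl = walk-trans
        (walk-along at i o (λ t _ t≤ → detour (next (s≤s (s≤s t≤))))
                           (λ t i<t t≤ → inY i<t (s≤s (≤-trans t≤ (n≤1+n _)))))
        (inY (s≤s (m≤m+n i o)) ≤-refl) (detour (edge-sym G₀ (close refl)))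
  where open Hole h

-- A stretch of a hole of G₀ on which G and G₀ agree is part of a hole of G, as soon as
-- every edge of G₀ can be replaced in G by a walk that stays away from the stretch.
module _ {n} {G₀ G : Graph n} {k} (h : Hole G₀ k) (s L : ℕ) (1≤s : 1 ≤ s) (s+L<k : suc (s + L) < k) (2≤L : 2 ≤ L)
         (Q : Fin n → Set) (detour : ∀ {x y} → Edge G₀ x y → Walk G Q x y)
         (keep⁺ : ∀ i → s ≤ i → i ≤ s + L → ∀ {z} → Edge G₀ (Hole.at h i) z → Edge G (Hole.at h i) z)
         (keep⁻ : ∀ i → s ≤ i → i ≤ s + L → ∀ {z} → Edge G (Hole.at h i) z → Edge G₀ (Hole.at h i) z)
         (Q-apart : ∀ i → s ≤ i → i ≤ s + L → ∀ {z} → Q z → Hole.at h i ≢ z × ¬ Edge G (Hole.at h i) z) where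
  private
    open Hole h

    Y : Fin n → Set
    Y z = (∃[ j ] j < k × (j < s ⊎ s + L < j) × z ≡ at j) ⊎ Q z

    wide : ∀ {x y} → Edge G₀ x y → Walk G Y x y
    wide e = walk-map (λ e → e) inj₂ (detour e)

    s<k : s < k
    s<k = ≤-<-trans (m≤m+n s L) (<⇒≤ s+L<k)

    rest-down : ∀ s′ → suc s′ ≡ s → Walk G Y (at 0) (at s)
    rest-down s′ refl = walk-along at 0 s′ (λ t _ t≤ → wide (next (≤-<-trans (s≤s t≤) s<k)))
                          (λ t 0<t t≤ → inj₁ (t , ≤-<-trans (≤-trans t≤ (n≤1+n _)) s<k , inj₁ (s≤s t≤) , refl))

    -- The complementary arc goes up from `s + L`, through the closing edge to index 0, and then up
    -- to `s`.
    rest : Walk G Y (at (s + L)) (at s)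
    rest = walk-trans (hole-walk-up h wide (<⇒≤ s+L<k) (λ <j j<k → inj₁ (_ , j<k , inj₂ <j , refl)))
             (inj₁ (0 , ≤-<-trans z≤n s<k , inj₁ 1≤s , refl))
             (rest-down (s ∸ 1) (m+[n∸m]≡n 1≤s))

    w : ℕ → Fin n
    w i = at (s + i)

    inside-≤ : ∀ {i} → i ≤ L → s + i ≤ s + L
    inside-≤ = +-monoʳ-≤ s

    inside-< : ∀ {i} → i ≤ L → s + i < k
    inside-< i≤L = ≤-<-trans (inside-≤ i≤L) (<⇒≤ s+L<k)

    shift : ∀ {i j} → suc i < j → suc (s + i) < s + j
    shift {i} {j} l = subst (_< s + j) (+-suc s i) (+-monoʳ-< s l)

    -- The stretch contains neither index 0 nor index `k ∸ 1`, so the closing edge, which `non` has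
    -- to except, never occurs here.
    far : ∀ i j → s ≤ i → i ≤ s + L → j < k → suc i < j ⊎ suc j < i → ¬ Edge G₀ (at i) (at j)
    far i j s≤i i≤ j<k (inj₁ i<j) = non i<j j<k (inj₁ (≤-trans 1≤s s≤i))
    far i j s≤i i≤ j<k (inj₂ j<i) e = non j<i (≤-<-trans i≤ (<⇒≤ s+L<k)) (inj₂ (≤-<-trans (s≤s i≤) s+L<k)) (edge-sym G₀ e)

    w-apart : ∀ {i b} → 0 < i → i < L → Y b → w i ≢ b × ¬ Edge G (w i) b
    w-apart {i} 0<i i<L (inj₂ Qb) = Q-apart (s + i) (m≤m+n s i) (inside-≤ (<⇒≤ i<L)) Qb
    w-apart {i} 0<i i<L (inj₁ (j , j<k , inj₁ j<s , refl)) =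
      (λ eq → dis (<-≤-trans j<s (m≤m+n s i)) (inside-< (<⇒≤ i<L)) (sym eq)) ,
      λ e → far (s + i) j (m≤m+n s i) (inside-≤ (<⇒≤ i<L)) j<k (inj₂ (≤-<-trans j<s (m<m+n s 0<i)))
              (keep⁻ (s + i) (m≤m+n s i) (inside-≤ (<⇒≤ i<L)) e)
    w-apart {i} 0<i i<L (inj₁ (j , j<k , inj₂ <j , refl)) =
      dis (<-trans (+-monoʳ-< s i<L) <j) j<k ,
      λ e → far (s + i) j (m≤m+n s i) (inside-≤ (<⇒≤ i<L)) j<k (inj₁ (≤-<-trans (+-monoʳ-< s i<L) <j))
              (keep⁻ (s + i) (m≤m+n s i) (inside-≤ (<⇒≤ i<L)) e)

    w-next : ∀ {i} → i < L → Edge G (w i) (w (suc i))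
    w-next {i} i<L = subst (λ j → Edge G (w i) (at j)) (sym (+-suc s i))
      (keep⁺ (s + i) (m≤m+n s i) (inside-≤ (<⇒≤ i<L)) (next (subst (_< k) (+-suc s i) (inside-< i<L))))

    w-non : ∀ {i j} → suc i < j → j ≤ L → ¬ Edge G (w i) (w j)
    w-non {i} {j} i<j j≤L e = far (s + i) (s + j) (m≤m+n s i) i≤ (inside-< j≤L) (inj₁ (shift i<j))
                                (keep⁻ (s + i) (m≤m+n s i) i≤ e)
      where
      i≤ : s + i ≤ s + L
      i≤ = inside-≤ (≤-trans (<⇒≤ (<⇒≤ i<j)) j≤L)

    w-dis : ∀ {i j} → i < j → j ≤ L → w i ≢ w j
    w-dis i<j j≤L = dis (+-monoʳ-< s i<j) (inside-< j≤L)

  block-hole : ∃[ k′ ] 2 + L ≤ k′ × Σ[ h′ ∈ Hole G k′ ]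
                 (∀ i → i < k′ → (∃[ j ] j < k × Hole.at h′ i ≡ at j) ⊎ Q (Hole.at h′ i))
  block-hole with segment-hole w L 2≤L w-next w-non w-dis w-apart
                    (subst (λ j → Walk G Y (at (s + L)) (at j)) (sym (+-identityʳ s)) rest)
  ... | k′ , le , h′ , inside = k′ , le , h′ , λ i i<k′ → place (inside i i<k′)
    where
    place : ∀ {z} → (∃[ j ] j ≤ L × z ≡ w j) ⊎ Y z → (∃[ j ] j < k × z ≡ at j) ⊎ Q z
    place (inj₁ (j , j≤L , eq))           = inj₁ (s + j , inside-< j≤L , eq)
    place (inj₂ (inj₁ (j , j<k , _ , eq))) = inj₁ (j , j<k , eq)
    place (inj₂ (inj₂ Qz))                = inj₂ Qz

-- Blocks on a hole, and the pigeonhole principle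

blockStart : ℕ → ℕ → ℕ
-- A block has `suc L` vertices. The multiples of `2 + L` are left over as separators; thus distinct
-- blocks are apart and index 0 is in no block.
blockStart L t = suc (t * (2 + L))

block : ∀ {A : Set} → (ℕ → A) → ℕ → ℕ → List A
block c L t = map (λ i → c (blockStart L t + i)) (upTo (suc L))

length-block : ∀ {A : Set} (c : ℕ → A) L t → length (block c L t) ≡ suc L
length-block c L t = trans (length-map _ (upTo (suc L))) (length-upTo (suc L))

InBlock : ℕ → ℕ → ℕ → Set
InBlock L t i = blockStart L t ≤ i × i ≤ blockStart L t + L

module _ {A : Set} (c : ℕ → A) (L t : ℕ) where

  ∈-block⁺ : ∀ {i} → InBlock L t i → c i ∈ block c L t
  ∈-block⁺ (lo , hi) with m≤n⇒∃[o]m+o≡n lo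
  ... | o , refl = ∈-map⁺ _ (∈-upTo⁺ (s≤s (+-cancelˡ-≤ (blockStart L t) _ _ hi)))

  ∈-block⁻ : ∀ {z} → z ∈ block c L t → ∃[ i ] InBlock L t i × z ≡ c i
  ∈-block⁻ z∈ with ∈-map⁻ _ z∈
  ... | i , i∈ , eq with ∈-upTo⁻ i∈
  ...   | s≤s i≤L = blockStart L t + i , (m≤m+n _ i , +-monoʳ-≤ (blockStart L t) i≤L) , eq

block-end : ∀ L t → suc (blockStart L t + L) ≡ suc t * (2 + L)
block-end L t = cong (λ m → suc (suc m)) (+-comm (t * (2 + L)) L)

block-fits : ∀ {L t T k} → t < T → T * (2 + L) < k → suc (blockStart L t + L) < k
block-fits {L} {t} t<T T<k =
  ≤-<-trans (≤-trans (≤-reflexive (block-end L t)) (*-monoˡ-≤ (2 + L) t<T)) T<k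

block-gap : ∀ {L t t′ i j} → t < t′ → InBlock L t i → InBlock L t′ j → suc i < j
block-gap {L} {t} {t′} {i} {j} t<t′ (_ , i≤) (≤j , _) = begin-strict
  suc i                       ≤⟨ s≤s i≤ ⟩
  suc (blockStart L t + L)    ≡⟨ block-end L t ⟩
  suc t * (2 + L)             <⟨ s≤s (*-monoˡ-≤ (2 + L) t<t′) ⟩
  blockStart L t′             ≤⟨ ≤j ⟩
  j                           ∎
  where open ≤-Reasoning

module _ {n} {G : Graph n} {k} (h : Hole G k) {L T : ℕ} (T<k : T * (2 + L) < k) where
  open Hole h

  private
    blocks-apart-< : ∀ {t t′} → t < t′ → t′ < T → Apart G (_∈ block at L t) (_∈ block at L t′)
    blocks-apart-< {t} {t′} t<t′ t′<T a∈ b∈ with ∈-block⁻ at L t a∈ | ∈-block⁻ at L t′ b∈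
    ... | i , i∈ , refl | j , j∈ , refl =
      dis (<⇒≤ i<j) j<k , non i<j j<k (inj₁ (≤-trans (s≤s z≤n) (proj₁ i∈)))
      where
      i<j : suc i < j
      i<j = block-gap {L} t<t′ i∈ j∈
      j<k : j < k
      j<k = ≤-<-trans (proj₂ j∈) (<⇒≤ (block-fits {L} t′<T T<k))

  blocks-apart : ∀ {t t′} → t ≢ t′ → t < T → t′ < T → Apart G (_∈ block at L t) (_∈ block at L t′)
  blocks-apart {t} {t′} t≢t′ t<T t′<T a∈ b∈ with <-cmp t t′
  ... | tri< t<t′ _ _ = blocks-apart-< t<t′ t′<T a∈ b∈
  ... | tri≈ _ eq _   = ⊥-elim (t≢t′ eq)
  ... | tri> _ _ t′<t with blocks-apart-< t′<t t<T b∈ a∈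
  ...   | b≢a , b≁a = ≢-sym b≢a , (b≁a ∘ edge-sym G)

AllPairs-resp-⊆ : ∀ {A : Set} {R : A → A → Set} {xs ys} → xs ⊆ ys → AllPairs R ys → AllPairs R xs
AllPairs-resp-⊆ []         []       = []
AllPairs-resp-⊆ (_ ∷ʳ p)   (_ ∷ rs) = AllPairs-resp-⊆ p rs
AllPairs-resp-⊆ (refl ∷ p) (r ∷ rs) = All-resp-⊆ p r ∷ AllPairs-resp-⊆ p rs

module _ {A C : Set} {R : A → C → Set} where
  private
    split : ∀ {c cs} ts → All (λ t → Any (R t) (c ∷ cs)) ts →
            ∃[ us ] ∃[ vs ] us ⊆ ts × vs ⊆ ts × All (λ t → R t c) us × All (λ t → Any (R t) cs) vs ×
              length us + length vs ≡ length ts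
    split [] [] = [] , [] , [] , [] , [] , [] , refl
    split (t ∷ ts) (r ∷ rs) with r | split ts rs
    ... | here r′  | us , vs , p , q , ru , rv , eq =
          t ∷ us , vs , refl ∷ p , t ∷ʳ q , r′ ∷ ru , rv , cong suc eq
    ... | there r′ | us , vs , p , q , ru , rv , eq =
          us , t ∷ vs , t ∷ʳ p , refl ∷ q , ru , r′ ∷ rv , trans (+-suc (length us) (length vs)) (cong suc eq)

  -- If the first colour has fewer than `K` elements, the others still exceed `K` times the number
  -- of remaining colours. The result is a sublist, so that distinctness passes to it by
  -- `AllPairs-resp-⊆`.
  pigeonhole : ∀ K cs ts → All (λ t → Any (R t) cs) ts → length cs * K < length ts →
               ∃[ c ] ∃[ us ] us ⊆ ts × All (λ t → R t c) us × length us ≡ K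
  pigeonhole K []       (t ∷ ts) (() ∷ _) _
  pigeonhole K (c ∷ cs) ts rs lt with split ts rs
  ... | us , vs , p , q , ru , rv , eq with K ≤? length us
  ...   | yes K≤ = c , take K us , ⊆-trans (take-⊆ K us) p , All-resp-⊆ (take-⊆ K us) ru
                 , trans (length-take K us) (m≤n⇒m⊓n≡m K≤)
  ...   | no K≰ with pigeonhole K cs vs rv (+-cancelˡ-< K _ _ (<-≤-trans lt
                       (≤-trans (≤-reflexive (sym eq)) (+-monoˡ-≤ (length vs) (≰⇒≥ K≰)))))
  ...     | c′ , ws , r , rw , eq′ = c′ , ws , ⊆-trans r q , rw , eq′

-- Fill-ins

_∈?_ : ∀ {n} (z : Fin n) zs → Dec (z ∈ zs)
_∈?_ = mem? _≟_

-- S lists each edge of H outside G in at least one of its two orientations, possibly with superfluous pairs.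
record Fill {n} (G : Graph n) (p : ℕ) (U : Fin n → Set) : Set where
  field
    H        : Graph n
    H-⊇      : ∀ {x y} → Edge G x y → Edge H x y
    S        : List (Fin n × Fin n)
    S-≤      : length S ≤ p
    cover    : ∀ {x y} → Edge H x y → Edge G x y ⊎ (x , y) ∈ S ⊎ (y , x) ∈ S
    -- Only holes inside `U` are forbidden: this speaks about the subgraph induced on `U` without
    -- relabelling its vertices.
    holeless : ∀ {k} (h : Hole H k) → ¬ (∀ i → i < k → U (Hole.at h i))

∈-remove : ∀ {A : Set} {a : A} {xs} → a ∈ xs →
           ∃[ ys ] length xs ≡ suc (length ys) × (∀ {z} → z ∈ xs → z ≡ a ⊎ z ∈ ys)
∈-remove {xs = _ ∷ xs} (here refl) = xs , refl , λ { (here eq) → inj₁ eq ; (there z∈) → inj₂ z∈ }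
∈-remove {xs = x ∷ xs} (there a∈) with ∈-remove a∈
... | ys , eq , f = x ∷ ys , cong suc eq , λ { (here eq) → inj₂ (here eq) ; (there z∈) → map₂ there (f z∈) }

module _ {n} {G : Graph n} where

  fill-mono : ∀ {p U V} → (∀ {z} → V z → U z) → Fill G p U → Fill G p V
  fill-mono f F = record
    { H = H ; H-⊇ = H-⊇ ; S = S ; S-≤ = S-≤ ; cover = cover
    ; holeless = λ h inV → holeless h (λ i i<k → f (inV i i<k)) }
    where open Fill F

  -- The supergraph `H` is kept. One occurrence of the pair for `uv` can leave `S`, because the edge
  -- it accounts for now belongs to `addEdge G u v`.
  fill-spend : ∀ {p U u v} (F : Fill G (suc p) U) → let open Fill F in
               Edge H u v → (u , v) ∈ S ⊎ (v , u) ∈ S → Fill (addEdge G u v) p U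
  fill-spend {p} {U} {u} {v} F uv∈H = go
    where
    open Fill F
    module _ (a b : Fin n) (ab : a ≡ u × b ≡ v ⊎ a ≡ v × b ≡ u) (ab∈S : (a , b) ∈ S) where
      S′ : List (Fin n × Fin n)
      S′ = proj₁ (∈-remove ab∈S)
      ⊇′ : ∀ {x y} → Edge (addEdge G u v) x y → Edge H x y
      ⊇′ e with addEdge⁻ G u v e
      ... | inj₁ e′ = H-⊇ e′
      ... | inj₂ (inj₁ (refl , refl)) = uv∈H
      ... | inj₂ (inj₂ (refl , refl)) = edge-sym H uv∈H
      u≢v : u ≢ v
      u≢v = edge⇒≢ H uv∈H
      ab-edge : Edge (addEdge G u v) a b
      ab-edge = [ (λ { (refl , refl) → addEdge-new G u v u≢v })
                , (λ { (refl , refl) → edge-sym (addEdge G u v) (addEdge-new G u v u≢v) }) ]′ ab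
      cover′ : ∀ {x y} → Edge H x y → Edge (addEdge G u v) x y ⊎ (x , y) ∈ S′ ⊎ (y , x) ∈ S′
      cover′ e with cover e
      ... | inj₁ e′ = inj₁ (addEdge-⊇ G u v e′)
      ... | inj₂ (inj₁ xy∈S) with proj₂ (proj₂ (∈-remove ab∈S)) xy∈S
      ...   | inj₁ refl  = inj₁ ab-edge
      ...   | inj₂ xy∈S′ = inj₂ (inj₁ xy∈S′)
      cover′ e | inj₂ (inj₂ yx∈S) with proj₂ (proj₂ (∈-remove ab∈S)) yx∈S
      ...   | inj₁ refl  = inj₁ (edge-sym (addEdge G u v) ab-edge)
      ...   | inj₂ yx∈S′ = inj₂ (inj₂ yx∈S′)
      spend : Fill (addEdge G u v) p U
      spend = record
        { H = H ; H-⊇ = ⊇′ ; S = S′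
        ; S-≤ = ≤-pred (subst (_≤ suc p) (proj₁ (proj₂ (∈-remove ab∈S))) S-≤)
        ; cover = cover′ ; holeless = holeless }
    go : (u , v) ∈ S ⊎ (v , u) ∈ S → Fill (addEdge G u v) p U
    go (inj₁ uv∈S) = spend u v (inj₁ (refl , refl)) uv∈S
    go (inj₂ vu∈S) = spend v u (inj₂ (refl , refl)) vu∈S

  fill-new : ∀ {p U u v} (F : Fill G (suc p) U) → Edge (Fill.H F) u v → ¬ Edge G u v → Fill (addEdge G u v) p U
  fill-new F uv∈H uv∉G with Fill.cover F uv∈H
  ... | inj₁ uv∈G = ⊥-elim (uv∉G uv∈G)
  ... | inj₂ uv∈S = fill-spend F uv∈H uv∈S

  fill-add : ∀ {p U u v} → Fill (addEdge G u v) p U → Fill G (suc p) U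
  fill-add {u = u} {v} F = record
    { H = H ; H-⊇ = λ e → H-⊇ (addEdge-⊇ G u v e) ; S = (u , v) ∷ S ; S-≤ = s≤s S-≤
    ; cover = λ e → cover′ (cover e) ; holeless = holeless }
    where
    open Fill F
    cover′ : ∀ {x y} → Edge (addEdge G u v) x y ⊎ (x , y) ∈ S ⊎ (y , x) ∈ S →
             Edge G x y ⊎ (x , y) ∈ (u , v) ∷ S ⊎ (y , x) ∈ (u , v) ∷ S
    cover′ (inj₂ (inj₁ p)) = inj₂ (inj₁ (there p))
    cover′ (inj₂ (inj₂ p)) = inj₂ (inj₂ (there p))
    cover′ (inj₁ e) with addEdge⁻ G u v e
    ... | inj₁ e′ = inj₁ e′
    ... | inj₂ (inj₁ (refl , refl)) = inj₂ (inj₁ (here refl))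
    ... | inj₂ (inj₂ (refl , refl)) = inj₂ (inj₂ (here refl))

  hole-resp : ∀ {H : Graph n} {k} (h : Hole G k) → let open Hole h in
              (∀ {x y} → Edge G x y → Edge H x y) →
              (∀ {i j} → suc i < j → j < k → 0 < i ⊎ suc j < k → ¬ Edge H (at i) (at j)) → Hole H k
  hole-resp h ⊇ non′ = record
    { at = at ; 4≤k = 4≤k ; dis = dis ; next = λ l → ⊇ (next l) ; close = λ e → ⊇ (close e) ; non = non′ }
    where open Hole h

-- A chord of a hole misses one of five disjoint blocks of the hole, and this block lies on a
-- hole that survives the addition of the chord; this gives the factor 5.
holeBound : ℕ → ℕ
-- The bound is used in the form `2 + holeBound p ≤ k`; for `p` equal to 0 this is `4 ≤ k`, which
-- holds for every hole.
holeBound zero    = 2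
holeBound (suc p) = 5 * (2 + holeBound p)

2≤holeBound : ∀ p → 2 ≤ holeBound p
2≤holeBound zero    = ≤-refl
2≤holeBound (suc p) = s≤s (s≤s z≤n)

holeBound-mono : ∀ p → holeBound p ≤ holeBound (suc p)
holeBound-mono p = ≤-trans (m≤n+m (holeBound p) 2) (m≤n*m (2 + holeBound p) 5)

module _ {n} {G : Graph n} {k} (h : Hole G k) {L T : ℕ} (T<k : T * (2 + L) < k) where
  open Hole h

  block-∈-unique : ∀ {z ts} → AllPairs _≢_ ts → All (λ t → t < T × z ∈ block at L t) ts → ¬ 2 ≤ length ts
  block-∈-unique {z} {t ∷ t′ ∷ _} ((t≢t′ ∷ _) ∷ _) ((t<T , z∈) ∷ (t′<T , z∈′) ∷ _) _ =
    proj₁ (blocks-apart h T<k t≢t′ t<T t′<T z∈ z∈′) refl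
  block-∈-unique {ts = _ ∷ []} _ _ (s≤s ())

-- Every edge of `G` survives in `addEdge G a b`, so the detours need no inner vertices and `Q` is
-- empty. Since `a` and `b` are off the block, the neighbourhoods of its vertices do not change.
block-hole-+edge : ∀ {n} {G : Graph n} {k} (h : Hole G k) {a b L t} → let open Hole h in
                   suc (blockStart L t + L) < k → 2 ≤ L → a ∉ block at L t → b ∉ block at L t →
                   ∃[ k′ ] 2 + L ≤ k′ × Σ[ h′ ∈ Hole (addEdge G a b) k′ ]
                     (∀ i → i < k′ → ∃[ j ] j < k × Hole.at h′ i ≡ at j)
block-hole-+edge {G = G} {k} h {a} {b} {L} {t} fits 2≤L a∉ b∉ =
  let k′ , long , h′ , inside = block-hole {G = addEdge G a b} h (blockStart L t) L (s≤s z≤n) fits 2≤L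
        (λ _ → ⊥) (λ e → edge (addEdge-⊇ G a b e)) (λ i _ _ → addEdge-⊇ G a b)
        (λ i lo hi → addEdge⁻-off G a b (off a∉ lo hi) (off b∉ lo hi)) (λ _ _ _ ())
  in k′ , long , h′ , λ i i<k′ → [ (λ p → p) , (λ ()) ]′ (inside i i<k′)
  where
  open Hole h
  off : ∀ {z} → z ∉ block at L t → ∀ {i} → blockStart L t ≤ i → i ≤ blockStart L t + L → at i ≢ z
  off z∉ lo hi refl = z∉ (∈-block⁺ at L t (lo , hi))

-- The pairs of `S` are treated one at a time. A pair that is not an edge of `H` is dropped; any
-- other is added to `G`, where a hole survives that is still too long for the remaining budget.
fill⇒no-long-hole : ∀ {n} p {G : Graph n} {U} → Fill G p U → ∀ {k} (h : Hole G k) →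
                    (∀ i → i < k → U (Hole.at h i)) → ¬ 2 + holeBound p ≤ k
fill⇒no-long-hole p record { H-⊇ = ⊇ ; S = [] ; cover = cover ; holeless = holeless } h inU long =
  holeless (hole-resp h ⊇ λ i<j j<k ends e → [ non i<j j<k ends , [ (λ ()) , (λ ()) ]′ ]′ (cover e)) inU
  where open Hole h
fill⇒no-long-hole (suc p) {G} {U} F@record { H = H ; H-⊇ = ⊇ ; S = (a , b) ∷ S ; S-≤ = s≤s S≤p ; cover = cover ; holeless = holeless }
                  {k} h inU long with edge? H a b
... | no ab∉H = fill⇒no-long-hole p {U = U} record
        { H = H ; H-⊇ = ⊇ ; S = S ; S-≤ = S≤p ; cover = cover′ ; holeless = holeless }
        h inU (≤-trans (s≤s (s≤s (holeBound-mono p))) long)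
  where
  cover′ : ∀ {x y} → Edge H x y → Edge G x y ⊎ (x , y) ∈ S ⊎ (y , x) ∈ S
  cover′ e with cover e
  ... | inj₁ e′                 = inj₁ e′
  ... | inj₂ (inj₁ (here refl)) = ⊥-elim (ab∉H e)
  ... | inj₂ (inj₁ (there xy))  = inj₂ (inj₁ xy)
  ... | inj₂ (inj₂ (here refl)) = ⊥-elim (ab∉H (edge-sym H e))
  ... | inj₂ (inj₂ (there yx))  = inj₂ (inj₂ yx)
-- By `hit`, a block missing both `a` and `b` contradicts the induction hypothesis. So all five
-- blocks contain `a` or `b`, and as five exceeds twice two, one of these vertices would lie in two
-- disjoint blocks.
... | yes ab∈H with pigeonhole {R = R} 2 (a ∷ b ∷ []) (upTo 5) (All.map hit (All.all-upTo 5)) ≤-refl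
  where
  open Hole h
  L : ℕ
  L = holeBound p
  T<k : 5 * (2 + L) < k
  T<k = <⇒≤ long
  R : ℕ → Fin _ → Set
  R t z = t < 5 × z ∈ block at L t
  F′ : Fill (addEdge G a b) p U
  F′ = fill-spend F ab∈H (inj₁ (here refl))
  hit : ∀ {t} → t < 5 → Any (R t) (a ∷ b ∷ [])
  hit {t} t<5 with a ∈? block at L t | b ∈? block at L t
  ... | yes a∈ | _      = here (t<5 , a∈)
  ... | no _   | yes b∈ = there (here (t<5 , b∈))
  ... | no a∉  | no b∉  = ⊥-elim (absurd (block-hole-+edge h {L = L} {t} (block-fits {L} t<5 T<k) (2≤holeBound p) a∉ b∉))
    where
    absurd : ¬ (∃[ k′ ] 2 + L ≤ k′ × Σ[ h′ ∈ Hole (addEdge G a b) k′ ] (∀ i → i < k′ → ∃[ j ] j < k × Hole.at h′ i ≡ at j))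
    absurd (k′ , long′ , h′ , inside) = fill⇒no-long-hole p F′ h′ inU′ long′
      where
      inU′ : ∀ i → i < k′ → U (Hole.at h′ i)
      inU′ i i<k′ with inside i i<k′
      ... | j , j<k , eq = subst U (sym eq) (inU j j<k)
...   | z , ts , ts⊆ , rs , len≡2 =
        block-∈-unique h {holeBound p} {5} (<⇒≤ long) (AllPairs-resp-⊆ ts⊆ (upTo⁺ 5)) rs (≤-reflexive (sym len≡2))

-- Forced edges

-- An element of `S` that meets one requirement meets no other, so it can be removed together with
-- that requirement. Double negation suffices for the hits because the conclusion is itself a
-- negation.
count : ∀ {I A : Set} (P : I → A → Set) is S → All (λ i → ¬ ¬ Any (P i) S) is →
        AllPairs (λ i j → ∀ a → P i a → ¬ P j a) is → ¬ length S < length is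
count P (i ∷ is) S (hit ∷ hits) (disj ∷ disjs) lt = hit λ Pi∈S → absurd (find Pi∈S)
  where
  absurd : ¬ (∃[ a ] a ∈ S × P i a)
  absurd (a , a∈S , Pia) with ∈-remove a∈S
  ... | S′ , len , f = count P is S′ (All.zipWith (λ (h , d) ¬h → h (¬h ∘ restrict d)) (hits , disj)) disjs
                         (≤-pred (subst (λ l → suc l ≤ suc (length is)) len lt))
    where
    restrict : ∀ {j} → (∀ a → P i a → ¬ P j a) → Any (P j) S → Any (P j) S′
    restrict d Pj∈S with find Pj∈S
    ... | b , b∈S , Pjb with f b∈S
    ...   | inj₁ refl = ⊥-elim (d a Pia Pjb)
    ...   | inj₂ b∈S′ = lose b∈S′ Pjb

-- This is the common form of the two configurations of the proof: two nonadjacent vertices of a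
-- hole with its two arcs, and two nonadjacent vertices with neighbours in many common blocks of a
-- long hole.
record Linked {n} (G : Graph n) (x y : Fin n) (Bs : List (List (Fin n))) : Set where
  field
    x≢y   : x ≢ y
    x≁y   : ¬ Edge G x y
    links : All (λ B → Walk G (_∈ B) x y × x ∉ B × y ∉ B) Bs
    apart : AllPairs (λ B C → Apart G (_∈ B) (_∈ C)) Bs

pairUp : ∀ {A : Set} → List A → List (A × A)
pairUp []           = []
pairUp (_ ∷ [])     = []
pairUp (x ∷ y ∷ xs) = (x , y) ∷ pairUp xs

length-pairUp : ∀ {A : Set} m (xs : List A) → length xs ≡ m + m → length (pairUp xs) ≡ m
length-pairUp zero    []           _  = refl
length-pairUp (suc m) (x ∷ [])     eq with () ← trans (suc-injective eq) (+-suc m m)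
length-pairUp (suc m) (x ∷ y ∷ xs) eq =
  cong suc (length-pairUp m xs (suc-injective (trans (suc-injective eq) (+-suc m m))))

pairUp-All : ∀ {A : Set} {P : A → Set} {xs} → All P xs → All (λ (x , y) → P x × P y) (pairUp xs)
pairUp-All []             = []
pairUp-All (_ ∷ [])       = []
pairUp-All (p ∷ q ∷ rest) = (p , q) ∷ pairUp-All rest

module _ {A : Set} {R : A → A → Set} where

  pairUp-related : ∀ {P : A → Set} {xs} → All P xs → AllPairs R xs → All (λ (x , y) → P x × P y × R x y) (pairUp xs)
  pairUp-related []             []                     = []
  pairUp-related (_ ∷ [])       _                      = []
  pairUp-related (p ∷ q ∷ rest) ((r ∷ _) ∷ (_ ∷ rs)) = (p , q , r) ∷ pairUp-related rest rs

  pairUp-AllPairs : ∀ {xs} → AllPairs R xs →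
    AllPairs (λ (x , y) (x′ , y′) → (R x x′ × R x y′) × (R y x′ × R y y′)) (pairUp xs)
  pairUp-AllPairs []                         = []
  pairUp-AllPairs (_ ∷ [])                   = []
  pairUp-AllPairs ((_ ∷ rs) ∷ (rs′ ∷ rest)) =
    All.zip (pairUp-All rs , pairUp-All rs′) ∷ pairUp-AllPairs rest

-- If xy is not an edge of H, any two blocks form with x and y a region that contains a hole of G,
-- so H has a new edge in each of the regions belonging to p + 1 disjoint pairs of blocks.
forced : ∀ {n} {G : Graph n} {p U x y Bs} → Linked G x y Bs → length Bs ≡ suc p + suc p →
         (F : Fill G p U) → U x → U y → (∀ {B} z → B ∈ Bs → z ∈ B → U z) → Edge (Fill.H F) x y
forced {n} {G} {p} {U} {x} {y} {Bs} lk len F Ux Uy UB with edge? (Fill.H F) x y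
... | yes e   = e
... | no xy∉H = ⊥-elim (count P (pairUp Bs) S
                  (All.map hit (pairUp-related (All.zip (links , All.tabulate (λ B∈ z → UB z B∈))) apart))
                  (AllPairs.map disjoint (pairUp-AllPairs apart))
                  (≤-trans (s≤s S-≤) (≤-reflexive (sym (length-pairUp (suc p) Bs len)))))
  where
  open Linked lk
  open Fill F

  Region : List (Fin n) × List (Fin n) → Fin n → Set
  Region (B , C) z = z ≡ x ⊎ z ≡ y ⊎ z ∈ B ⊎ z ∈ C

  -- All regions share `x` and `y`. Asking for one end off these two is what makes the requirements
  -- of different pairs of blocks disjoint.
  Proper : List (Fin n) × List (Fin n) → Fin n → Set
  Proper (B , C) z = (z ∈ B ⊎ z ∈ C) × z ≢ x × z ≢ y

  P : List (Fin n) × List (Fin n) → Fin n × Fin n → Set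
  P BC (a , b) = Region BC a × Region BC b × (Proper BC a ⊎ Proper BC b)

  Link : List (Fin n) → Set
  Link B = (Walk G (_∈ B) x y × x ∉ B × y ∉ B) × (∀ z → z ∈ B → U z)

  disjoint : ∀ {BC BC′ : List (Fin n) × List (Fin n)} →
             let (B , C) = BC ; (B′ , C′) = BC′ ; R = λ B C → Apart G (_∈ B) (_∈ C) in
             (R B B′ × R B C′) × (R C B′ × R C C′) → ∀ ab → P BC ab → ¬ P BC′ ab
  disjoint {BC} {BC′} ((BB′ , BC′′) , (CB′ , CC′)) (a , b) (_ , _ , pr) (ra , rb , _) =
    [ (λ pa → clash pa ra) , (λ pb → clash pb rb) ]′ pr
    where
    clash : ∀ {z} → Proper BC z → ¬ Region BC′ z
    clash (_ , z≢x , _) (inj₁ eq) = z≢x eq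
    clash (_ , _ , z≢y) (inj₂ (inj₁ eq)) = z≢y eq
    clash (inj₁ z∈B , _) (inj₂ (inj₂ (inj₁ z∈B′))) = proj₁ (BB′ z∈B z∈B′) refl
    clash (inj₁ z∈B , _) (inj₂ (inj₂ (inj₂ z∈C′))) = proj₁ (BC′′ z∈B z∈C′) refl
    clash (inj₂ z∈C , _) (inj₂ (inj₂ (inj₁ z∈B′))) = proj₁ (CB′ z∈C z∈B′) refl
    clash (inj₂ z∈C , _) (inj₂ (inj₂ (inj₂ z∈C′))) = proj₁ (CC′ z∈C z∈C′) refl

  hit : ∀ {BC : List (Fin n) × List (Fin n)} → let (B , C) = BC in Link B × Link C × Apart G (_∈ B) (_∈ C) → ¬ ¬ Any (P BC) S
  hit {B , C} (((wB , x∉B , y∉B) , UB) , ((wC , x∉C , y∉C) , UC) , BC) miss =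
    -- If no pair of `S` hits the region, `B` and `C` are still apart in `H`. The two walks,
    -- shortened in `H`, then form a hole of `H` inside `U`.
    holeless (glue H-apart x≢y xy∉H PB PC) (λ i i<k → place (glue-inside H-apart x≢y xy∉H PB PC i i<k))
    where
    PB : InducedPath H (_∈ B) x y
    PB = inducedPath (walk-map H-⊇ (λ p → p) wB)
    PC : InducedPath H (_∈ C) y x
    PC = inducedPath (walk-map H-⊇ (λ p → p) (walk-sym wC))
    proper : ∀ {a} → a ∈ B → Proper (B , C) a
    proper a∈B = inj₁ a∈B , (λ { refl → x∉B a∈B }) , (λ { refl → y∉B a∈B })
    H-apart : Apart H (_∈ B) (_∈ C)
    H-apart a∈B b∈C = proj₁ (BC a∈B b∈C) , λ e → [ proj₂ (BC a∈B b∈C) , [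
      (λ ab∈S → miss (lose ab∈S (inj₂ (inj₂ (inj₁ a∈B)) , inj₂ (inj₂ (inj₂ b∈C)) , inj₁ (proper a∈B)))) ,
      (λ ba∈S → miss (lose ba∈S (inj₂ (inj₂ (inj₂ b∈C)) , inj₂ (inj₂ (inj₁ a∈B)) , inj₂ (proper a∈B)))) ]′ ]′ (cover e)
    place : ∀ {z} → z ≡ x ⊎ z ≡ y ⊎ z ∈ B ⊎ z ∈ C → U z
    place (inj₁ refl)               = Ux
    place (inj₂ (inj₁ refl))        = Uy
    place (inj₂ (inj₂ (inj₁ z∈B))) = UB _ z∈B
    place (inj₂ (inj₂ (inj₂ z∈C))) = UC _ z∈C

-- Relinking along a long hole

length-cartesianProduct : ∀ {A B : Set} (xs : List A) (ys : List B) →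
                          length (cartesianProduct xs ys) ≡ length xs * length ys
length-cartesianProduct []       ys = refl
length-cartesianProduct (x ∷ xs) ys = trans (length-++ (map (x ,_) ys))
  (cong₂ _+_ (length-map (x ,_) ys) (length-cartesianProduct xs ys))

AllPairs-zip-All : ∀ {A : Set} {P : A → Set} {R : A → A → Set} {xs} → All P xs → AllPairs R xs →
                   AllPairs (λ x y → P x × P y × R x y) xs
AllPairs-zip-All []       []       = []
AllPairs-zip-All (p ∷ ps) (r ∷ rs) = All.zipWith (λ (q , r) → p , q , r) (ps , r) ∷ AllPairs-zip-All ps rs

-- A block of the long hole is coloured by a vertex of {u, v} ∪ B ∪ C inside it or, failing this,
-- by a pair in B × C of which both members have a neighbour in the block.
colours : ℕ → ℕ
colours b = 2 + (b + b) + b * b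

-- With one block more than `colours b * K`, some colour occurs `K` times; each block together with
-- its separator takes `2 + L` indices.
longLinks : (L K b : ℕ) → ℕ
longLinks L K b = suc (colours b * K) * (2 + L)

module _ {n} {G : Graph n} {L : ℕ} (2≤L : 2 ≤ L) (short : ∀ {k} → Hole G k → ¬ 2 + L ≤ k)
         {u v B C} (lk : Linked G u v (B ∷ C ∷ [])) {b : ℕ} (B≤b : length B ≤ b) (C≤b : length C ≤ b)
         {K : ℕ} (2≤K : 2 ≤ K) {k} (h : Hole (addEdge G u v) k) (long : longLinks L K b < k) where
  private
    open Hole h
    open Linked lk

    T : ℕ
    T = suc (colours b * K)

    BC-apart : Apart G (_∈ B) (_∈ C)
    BC-apart = All.head (AllPairs.head apart)

    touched : List (Fin n)
    touched = u ∷ v ∷ (B ++ C)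

    Free : ℕ → Set
    Free t = ∀ z → z ∈ touched → z ∉ block at L t

    Seen : ℕ → Fin n → Set
    Seen t x = Any (Edge G x) (block at L t)

    off : ∀ {t z i} → Free t → z ∈ touched → InBlock L t i → at i ≢ z
    off {t} {z} free z∈ i∈ refl = free z z∈ (∈-block⁺ at L t i∈)

    keep : ∀ {t i z} → Free t → InBlock L t i → Edge (addEdge G u v) (at i) z → Edge G (at i) z
    keep {t} free i∈ = addEdge⁻-off G u v (off {t} free (here refl) i∈) (off {t} free (there (here refl)) i∈)

    detour : ∀ {D} → Walk G (_∈ D) u v → ∀ {x y} → Edge (addEdge G u v) x y → Walk G (_∈ D) x y
    detour w e with addEdge⁻ G u v e
    ... | inj₁ e′ = edge e′
    ... | inj₂ (inj₁ (refl , refl)) = w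
    ... | inj₂ (inj₂ (refl , refl)) = walk-sym w

    -- Otherwise the block would lie on a long hole of G, closed up through D.
    seen : ∀ {t} → t < T → Free t → ∀ D → Walk G (_∈ D) u v → (∀ {z} → z ∈ D → z ∈ touched) → Any (Seen t) D
    seen {t} t<T free D w D⊆ with Any.any? (λ x → Any.any? (edge? G x) (block at L t)) D
    ... | yes s    = s
    ... | no none = ⊥-elim (short (proj₁ (proj₂ (proj₂ found))) (proj₁ (proj₂ found)))
      where
      found : ∃[ k′ ] 2 + L ≤ k′ × Σ[ h′ ∈ Hole G k′ ] _
      found = block-hole {G = G} h (blockStart L t) L (s≤s z≤n) (block-fits {L} t<T long) 2≤L
        (_∈ D) (detour w) (λ i lo hi → keep {t} free (lo , hi)) (λ i _ _ → addEdge-⊇ G u v)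
        (λ i lo hi z∈D → off {t} free (D⊆ z∈D) (lo , hi) ,
           λ e → none (lose z∈D (lose (∈-block⁺ at L t (lo , hi)) (edge-sym G e))))

    Colour : Set
    Colour = Fin n ⊎ Fin n × Fin n

    R : ℕ → Colour → Set
    R t (inj₁ z)       = t < T × z ∈ block at L t
    R t (inj₂ (x , y)) = t < T × Free t × (x ∈ B × Seen t x) × (y ∈ C × Seen t y)

    palette : List Colour
    palette = map inj₁ touched ++ map inj₂ (cartesianProduct B C)

    length-palette : length palette ≤ colours b
    length-palette = begin
      length palette
        ≡⟨ length-++ (map inj₁ touched) ⟩
      length (map inj₁ touched) + length (map (inj₂ {A = Fin n}) (cartesianProduct B C))
        ≡⟨ cong₂ _+_ (length-map inj₁ touched) (length-map inj₂ (cartesianProduct B C)) ⟩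
      2 + length (B ++ C) + length (cartesianProduct B C)
        ≡⟨ cong₂ (λ a c → 2 + a + c) (length-++ B) (length-cartesianProduct B C) ⟩
      2 + (length B + length C) + length B * length C
        ≤⟨ +-mono-≤ (+-monoʳ-≤ 2 (+-mono-≤ B≤b C≤b)) (*-mono-≤ B≤b C≤b) ⟩
      colours b ∎
      where open ≤-Reasoning

    coloured : ∀ {t} → t < T → Any (R t) palette
    coloured {t} t<T with Any.any? (λ z → z ∈? block at L t) touched
    ... | yes z∈ = Any.++⁺ˡ (Any.map⁺ (Any.map (t<T ,_) z∈))
    ... | no none with find (seen t<T free B (proj₁ (All.head links)) (λ z∈ → there (there (∈-++⁺ˡ z∈))))
                     | find (seen t<T free C (proj₁ (All.head (All.tail links))) (λ z∈ → there (there (∈-++⁺ʳ B z∈))))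
      where
      free : Free t
      free z z∈ z∈block = none (lose z∈ z∈block)
    ...   | x , x∈B , sx | y , y∈C , sy =
            Any.++⁺ʳ (map inj₁ touched) (Any.map⁺ (lose (∈-cartesianProduct⁺ x∈B y∈C)
              (t<T , (λ z z∈ z∈block → none (lose z∈ z∈block)) , (x∈B , sx) , (y∈C , sy))))

    block-walk-< : ∀ {t i j} → t < T → Free t → InBlock L t i → InBlock L t j → i < j →
                   Walk G (_∈ block at L t) (at i) (at j)
    block-walk-< {t} {i} t<T free (lo , _) (_ , hi) i<j with m≤n⇒∃[o]m+o≡n i<j
    ... | o , refl = walk-along at i o
      (λ s i≤s s≤ → edge (keep {t} free (≤-trans lo i≤s , ≤-trans (≤-trans s≤ (n≤1+n _)) hi)
         (next (≤-<-trans (≤-trans (s≤s s≤) hi) (<⇒≤ (block-fits {L} t<T long))))))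
      (λ s i<s s≤ → ∈-block⁺ at L t (≤-trans lo (<⇒≤ i<s) , ≤-trans (≤-trans s≤ (n≤1+n _)) hi))

    -- The walk enters the block at a neighbour of `x` and follows it to a neighbour of `y`. Its
    -- edges belong to `G` because a free block contains neither `u` nor `v`.
    block-link : ∀ {t x y} → t < T → Free t → Seen t x → Seen t y → Walk G (_∈ block at L t) x y
    block-link {t} t<T free sx sy with find sx | find sy
    ... | _ , i∈ , ex | _ , j∈ , ey with ∈-block⁻ at L t i∈ | ∈-block⁻ at L t j∈
    ...   | i , I , refl | j , J , refl with <-cmp i j
    ...     | tri< i<j _ _ = step ex i∈ (walk-trans (block-walk-< t<T free I J i<j) j∈ (edge (edge-sym G ey)))
    ...     | tri≈ _ refl _ = step ex i∈ (edge (edge-sym G ey))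
    ...     | tri> _ _ j<i = step ex i∈ (walk-trans (walk-sym (block-walk-< t<T free J I j<i)) j∈ (edge (edge-sym G ey)))

  -- The repeated colour is a pair `(x , y)`, and each of its blocks links `x` to `y`. Nonadjacency
  -- of `x` and `y` comes from `B` and `C` being apart; blocks apart in `addEdge G u v` are so in
  -- `G`.
  relink : ∃[ x ] ∃[ y ] ∃[ Ds ] x ∈ B × y ∈ C × Linked G x y Ds × length Ds ≡ K × All (λ D → length D ≡ suc L) Ds
  relink = finish (pigeonhole {R = R} K palette (upTo T) (All.map coloured (All.all-upTo T))
             (≤-trans (s≤s (*-monoˡ-≤ K length-palette)) (≤-reflexive (sym (length-upTo T)))))
    where
    G-apart : ∀ {t t′} → t < T × t′ < T × t ≢ t′ → Apart G (_∈ block at L t) (_∈ block at L t′)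
    G-apart (t<T , t′<T , t≢t′) a∈ b∈ =
      let a≢b , a≁b = blocks-apart h {L} {T} long t≢t′ t<T t′<T a∈ b∈ in a≢b , a≁b ∘ addEdge-⊇ G u v

    finish : ∃[ c ] ∃[ ts ] ts ⊆ upTo T × All (λ t → R t c) ts × length ts ≡ K → _
    -- A vertex lies in at most one block, so it cannot be the colour of `K ≥ 2` blocks.
    finish (inj₁ z , ts , ts⊆ , rs , len) =
      ⊥-elim (block-∈-unique h {L} {T} long (AllPairs-resp-⊆ ts⊆ (upTo⁺ T)) rs (subst (2 ≤_) (sym len) 2≤K))
    finish (inj₂ _ , [] , _ , _ , len) = ⊥-elim (<⇒≱ 2≤K (subst (_≤ 1) len z≤n))
    finish (inj₂ (x , y) , ts@(_ ∷ _) , ts⊆ , rs@((_ , _ , (x∈B , _) , (y∈C , _)) ∷ _) , len) =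
      x , y , map (block at L) ts , x∈B , y∈C , record
        { x≢y   = proj₁ (BC-apart x∈B y∈C)
        ; x≁y   = proj₂ (BC-apart x∈B y∈C)
        ; links = All.map⁺ (All.map (λ (t<T , free , (_ , sx) , (_ , sy)) →
                    block-link t<T free sx sy
                    , free x (there (there (∈-++⁺ˡ x∈B))) , free y (there (there (∈-++⁺ʳ B y∈C)))) rs)
        ; apart = AllPairs.map⁺ (AllPairs.map (λ {t} {t′} → G-apart {t} {t′})
                    (AllPairs-zip-All (All.map proj₁ rs) (AllPairs-resp-⊆ ts⊆ (upTo⁺ T))))
        }
      , trans (length-map (block at L) ts) len
      , All.map⁺ (All.universal (length-block at L) ts)

-- The induction on p

hole-injective : ∀ {n} {G : Graph n} {k} (h : Hole G k) → let open Hole h in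
                 ∀ {i j} → i < k → j < k → at i ≡ at j → i ≡ j
hole-injective h {i} {j} i<k j<k eq with <-cmp i j
... | tri< i<j _ _ = ⊥-elim (Hole.dis h i<j j<k eq)
... | tri≈ _ i≡j _ = i≡j
... | tri> _ _ j<i = ⊥-elim (Hole.dis h j<i i<k (sym eq))

Chord : (k a b : ℕ) → Set
Chord k a b = suc a < b × b < k × (0 < a ⊎ suc b < k)

chord? : ∀ k a b → Dec (Chord k a b)
chord? k a b = (suc a <? b) ×-dec (b <? k) ×-dec ((0 <? a) ⊎-dec (suc b <? k))

module _ {n} {G : Graph n} {k} (h : Hole G k) where
  open Hole h

  arc : {P : ℕ → Set} → (∀ i → Dec (P i)) → List (Fin n)
  arc P? = map at (filter P? (upTo k))

  module _ {P : ℕ → Set} (P? : ∀ i → Dec (P i)) where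

    length-arc : length (arc P?) ≤ k
    length-arc = ≤-trans (≤-reflexive (length-map at (filter P? (upTo k))))
                   (≤-trans (length-filter P? (upTo k)) (≤-reflexive (length-upTo k)))

    ∈-arc⁺ : ∀ {i} → i < k → P i → at i ∈ arc P?
    ∈-arc⁺ i<k Pi = ∈-map⁺ at (∈-filter⁺ P? (∈-upTo⁺ i<k) Pi)

    ∈-arc⁻ : ∀ {z} → z ∈ arc P? → ∃[ i ] i < k × P i × z ≡ at i
    ∈-arc⁻ z∈ with ∈-map⁻ at z∈
    ... | i , i∈ , eq with ∈-filter⁻ P? {xs = upTo k} i∈
    ...   | i∈upTo , Pi = i , ∈-upTo⁻ i∈upTo , Pi , eq

    ∉-arc : ∀ {i} → i < k → ¬ P i → at i ∉ arc P?
    ∉-arc i<k ¬Pi i∈ with ∈-arc⁻ i∈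
    ... | j , j<k , Pj , eq = ¬Pi (subst P (sym (hole-injective h i<k j<k eq)) Pj)

  inner? : ∀ a b i → Dec (a < i × i < b)
  inner? a b i = (a <? i) ×-dec (i <? b)

  outer? : ∀ a b i → Dec (i < a ⊎ b < i)
  outer? a b i = (i <? a) ⊎-dec (b <? i)

  chord-linked : ∀ {a b} → Chord k a b → Linked G (at a) (at b) (arc (inner? a b) ∷ arc (outer? a b) ∷ [])
  chord-linked {a} {b} (a<b , b<k , ends) = record
    { x≢y   = dis (<⇒≤ a<b) b<k
    ; x≁y   = non a<b b<k ends
    ; links = (inner-walk , ∉-arc (inner? a b) a<k (λ (l , _) → <-irrefl refl l)
                          , ∉-arc (inner? a b) b<k (λ (_ , l) → <-irrefl refl l))
            ∷ (outer-walk , ∉-arc (outer? a b) a<k [ <-irrefl refl , <-asym (<⇒≤ a<b) ]′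
                          , ∉-arc (outer? a b) b<k [ <-asym (<⇒≤ a<b) , <-irrefl refl ]′) ∷ []
    ; apart = (apart ∷ []) ∷ [] ∷ []
    }
    where
    a<k : a < k
    a<k = <-trans (<⇒≤ a<b) b<k

    inner-walk : Walk G (_∈ arc (inner? a b)) (at a) (at b)
    inner-walk with m≤n⇒∃[o]m+o≡n (<⇒≤ a<b)
    ... | o , eq = subst (λ j → Walk G (_∈ arc (inner? a b)) (at a) (at j)) eq (walk-along at a o
      (λ t _ t≤ → edge (next (≤-<-trans (≤-trans (s≤s t≤) (≤-reflexive eq)) b<k)))
      (λ t a<t t≤ → let t<b = ≤-trans (s≤s t≤) (≤-reflexive eq) in
                    ∈-arc⁺ (inner? a b) (<-trans t<b b<k) (a<t , t<b)))

    -- The outer arc passes through index 0: for `a` equal to 0 it ends there, otherwise it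
    -- continues from 0 up to `a`.
    down : ∀ a′ → a′ ≡ a → Walk G (_∈ arc (outer? a b)) (at b) (at 0) → Walk G (_∈ arc (outer? a b)) (at b) (at a)
    down zero     refl w = w
    down (suc a′) refl w = walk-trans w (∈-arc⁺ (outer? a b) (≤-<-trans z≤n a<k) (inj₁ (s≤s z≤n)))
      (walk-along at 0 a′ (λ t _ t≤ → edge (next (≤-<-trans (s≤s t≤) a<k)))
                          (λ t _ t≤ → ∈-arc⁺ (outer? a b) (≤-<-trans (≤-trans t≤ (n≤1+n _)) a<k) (inj₁ (s≤s t≤))))

    outer-walk : Walk G (_∈ arc (outer? a b)) (at a) (at b)
    outer-walk = walk-sym (down a refl (hole-walk-up h edge b<k (λ b<j j<k → ∈-arc⁺ (outer? a b) j<k (inj₂ b<j))))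

    apart : Apart G (_∈ arc (inner? a b)) (_∈ arc (outer? a b))
    apart x∈ y∈ with ∈-arc⁻ (inner? a b) x∈ | ∈-arc⁻ (outer? a b) y∈
    ... | i , i<k , (a<i , i<b) , refl | j , j<k , inj₁ j<a , refl =
      (λ eq → dis (<-trans j<a a<i) i<k (sym eq)) ,
      (λ e → non (≤-<-trans j<a a<i) i<k (inj₂ (≤-<-trans i<b b<k)) (edge-sym G e))
    ... | i , i<k , (a<i , i<b) , refl | j , j<k , inj₂ b<j , refl =
      dis (<-trans i<b b<j) j<k , non (≤-<-trans i<b b<j) j<k (inj₁ (≤-<-trans z≤n a<i))

length-concat : ∀ {A : Set} {m} {xss : List (List A)} → All (λ xs → length xs ≡ m) xss →
                length (concat xss) ≡ length xss * m
length-concat []                        = refl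
length-concat {xss = xs ∷ _} (eq ∷ eqs) = trans (length-++ xs) (cong₂ _+_ eq (length-concat eqs))

-- The double negation makes Good provable by contradiction; only a contradiction is ever drawn from it.
record Good {n} (N p : ℕ) (G : Graph n) : Set where
  field
    local  : ∀ U → length U ≤ N → ¬ ¬ Fill G p (_∈ U)
    noLong : ∀ {k} → Hole G k → ¬ N < k

-- By `noLong` a hole has at most `N` vertices, so `local` applies to its vertex set. This improves
-- the bound `N` to one depending on `p` alone.
good⇒short : ∀ {n N p} {G : Graph n} → Good N p G → ∀ {k} → Hole G k → ¬ 2 + holeBound p ≤ k
good⇒short {N = N} {p} good {k} h long =
  Good.local good (map at (upTo k)) (subst (_≤ N) (sym len) (≮⇒≥ (Good.noLong good h)))
    λ F → fill⇒no-long-hole p F h (λ i i<k → ∈-map⁺ at (∈-upTo⁺ i<k)) long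
  where
  open Hole h
  len : length (map at (upTo k)) ≡ k
  len = trans (length-map at (upTo k)) (length-upTo k)

Everywhere : ∀ {n} → Fin n → Set
Everywhere _ = ⊤

-- The threshold is independent of the graph and of its order; this uniformity is what gives
-- finiteness in the end.
Sufficient : ℕ → ℕ → Set
Sufficient p N₀ = ∀ {n N} {G : Graph n} → N₀ ≤ N → Good N p G → ¬ ¬ Fill G p Everywhere

module Step (q N₀ : ℕ) (IH : Sufficient q N₀) where

  -- Holes of `G` have at most `suc L` vertices, and blocks have exactly `suc L`. `K` is the number
  -- of blocks that `forced` asks for, and `M` is large enough both for the induction hypothesis and
  -- for `relink`.
  p L K M support-size N₁ : ℕ
  p = suc q
  L = holeBound p
  K = suc p + suc p
  M = N₀ + longLinks L K (suc L)
  support-size = 2 + K * suc L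
  -- The summands bound the three kinds of sets to which `local` is applied: a hole with a set of
  -- size `M` per pair of indices, a set of size `M` with one support, and the union of fewer than
  -- `K` supports.
  N₁ = (suc L + (suc L * suc L) * M) + ((M + support-size) + K * support-size)

  2≤K : 2 ≤ K
  2≤K = s≤s (s≤s z≤n)

  module _ {n N} {G : Graph n} (N₁≤N : N₁ ≤ N) (good : Good N p G) (notFill : ¬ Fill G p Everywhere) where
    open Good good

    support : (x y : Fin n) → List (List (Fin n)) → List (Fin n)
    support x y Ds = x ∷ y ∷ concat Ds

    Blocks : List (List (Fin n)) → Set
    Blocks Ds = length Ds ≡ K × All (λ D → length D ≡ suc L) Ds

    length-support : ∀ {x y Ds} → Blocks Ds → length (support x y Ds) ≡ support-size
    length-support (len , lens) = cong (2 +_) (trans (length-concat lens) (cong (_* suc L) len))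

    forced-on-support : ∀ {x y Ds} → Linked G x y Ds → Blocks Ds → ∀ {U} (F : Fill G p U) →
                        (∀ {z} → z ∈ support x y Ds → U z) → Edge (Fill.H F) x y
    forced-on-support lk (len , _) F inU = forced lk len F (inU (here refl)) (inU (there (here refl)))
      (λ z D∈ z∈ → inU (there (there (∈-concat⁺′ z∈ D∈))))

    Relinked : List (Fin n) → List (Fin n) → Set
    Relinked B C = ∃[ x ] ∃[ y ] ∃[ Ds ] x ∈ B × y ∈ C × Linked G x y Ds × Blocks Ds

    relink′ : ∀ {u v B C} → Linked G u v (B ∷ C ∷ []) → length B ≤ suc L → length C ≤ suc L →
              ∀ {k} → Hole (addEdge G u v) k → M < k → Relinked B C
    relink′ lk B≤ C≤ h long =
      relink (2≤holeBound p) (good⇒short good) lk B≤ C≤ 2≤K h (≤-<-trans (m≤n+m _ N₀) long)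

    module _ {x y Ds} (lk : Linked G x y Ds) (blocks : Blocks Ds) where

      -- A fill-in of `G` for `U` and the support must contain the forced edge `xy`, so one of its
      -- pairs is spent on this edge.
      local′ : ∀ U → length U ≤ M → ¬ ¬ Fill (addEdge G x y) q (_∈ U)
      local′ U U≤M notFill′ = local (U ++ support x y Ds) (≤-trans len N₁≤N) λ F →
        notFill′ (fill-mono ∈-++⁺ˡ (fill-new F (forced-on-support lk blocks F (∈-++⁺ʳ U)) (Linked.x≁y lk)))
        where
        len : length (U ++ support x y Ds) ≤ N₁
        len = begin
          length (U ++ support x y Ds)         ≡⟨ length-++ U ⟩
          length U + length (support x y Ds)   ≤⟨ +-mono-≤ U≤M (≤-reflexive (length-support {x} {y} blocks)) ⟩
          M + support-size                     ≤⟨ m≤m+n _ _ ⟩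
          (M + support-size) + K * support-size ≤⟨ m≤n+m _ (suc L + (suc L * suc L) * M) ⟩
          N₁                                   ∎
          where open ≤-Reasoning

    -- Every further block D yields a forced new edge between D₀ and D; there are more than p of them.
    no-long-hole′ : ∀ {x y Ds} → Linked G x y Ds → Blocks Ds → ∀ {k} → Hole (addEdge G x y) k → ¬ M < k
    no-long-hole′ {Ds = []} lk (len , _) h long = <⇒≢ (≤-trans (s≤s z≤n) 2≤K) len
    no-long-hole′ {x} {y} {D₀ ∷ Ds} lk@record { links = l₀ ∷ ls ; apart = aps₀ ∷ aps } (len , len₀ ∷ lens) {k} h long =
      -- `W` unites the supports of all these forced edges, so a single local fill-in has to contain
      -- every one of them.
      let W , W≤ , W-forces = collect Ds (All.map relinked (All.zip (ls , All.zip (aps₀ , lens)))) in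
      local W (≤-trans (W≤N₁ W≤) N₁≤N) λ F →
        count P Ds (Fill.S F) (All.map (λ hit none → none (covered F hit)) (W-forces F (λ z∈ → z∈)))
          (AllPairs.map (λ {D} {D′} → disjoint {D} {D′}) (AllPairs-zip-All {P = λ D → Apart G (_∈ D₀) (_∈ D)} aps₀ aps))
          (≤-trans (s≤s (Fill.S-≤ F)) p<Ds)
      where
      relinked : ∀ {D} → (Walk G (_∈ D) x y × x ∉ D × y ∉ D) × Apart G (_∈ D₀) (_∈ D) × length D ≡ suc L → Relinked D₀ D
      relinked (l , ap , lenD) = relink′ record
        { x≢y = Linked.x≢y lk ; x≁y = Linked.x≁y lk ; links = l₀ ∷ l ∷ [] ; apart = (ap ∷ []) ∷ [] ∷ [] }
        (≤-reflexive len₀) (≤-reflexive lenD) h long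

      NewEdge : Graph n → List (Fin n) → Set
      NewEdge H D = ∃[ a ] ∃[ b ] a ∈ D₀ × b ∈ D × Edge H a b × ¬ Edge G a b

      collect : ∀ Ds → All (Relinked D₀) Ds →
                ∃[ W ] length W ≤ length Ds * support-size ×
                  (∀ {U} (F : Fill G p U) → (∀ {z} → z ∈ W → U z) → All (NewEdge (Fill.H F)) Ds)
      collect [] [] = [] , z≤n , λ _ _ → []
      collect (D ∷ Ds) ((a , b , Es , a∈ , b∈ , lk′ , blocks′) ∷ rs) =
        let W , W≤ , f = collect Ds rs in
        support a b Es ++ W ,
        ≤-trans (≤-reflexive (length-++ (support a b Es))) (+-mono-≤ (≤-reflexive (length-support {a} {b} blocks′)) W≤) ,
        λ F inU → (a , b , a∈ , b∈ , forced-on-support lk′ blocks′ F (λ z∈ → inU (∈-++⁺ˡ z∈)) , Linked.x≁y lk′)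
                  ∷ f F (λ z∈ → inU (∈-++⁺ʳ (support a b Es) z∈))

      P : List (Fin n) → Fin n × Fin n → Set
      P D (a , b) = a ∈ D₀ × b ∈ D ⊎ b ∈ D₀ × a ∈ D

      covered : ∀ {U} (F : Fill G p U) {D} → NewEdge (Fill.H F) D → Any (P D) (Fill.S F)
      covered F (a , b , a∈ , b∈ , e , a≁b) with Fill.cover F e
      ... | inj₁ e′           = ⊥-elim (a≁b e′)
      ... | inj₂ (inj₁ ab∈S) = lose ab∈S (inj₁ (a∈ , b∈))
      ... | inj₂ (inj₂ ba∈S) = lose ba∈S (inj₂ (a∈ , b∈))

      disjoint : ∀ {D D′} → Apart G (_∈ D₀) (_∈ D) × Apart G (_∈ D₀) (_∈ D′) × Apart G (_∈ D) (_∈ D′) →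
                 ∀ ab → P D ab → ¬ P D′ ab
      disjoint (D₀D , D₀D′ , DD′) _ (inj₁ (a₀ , b)) (inj₁ (_ , b′))  = proj₁ (DD′ b b′) refl
      disjoint (D₀D , D₀D′ , DD′) _ (inj₁ (a₀ , b)) (inj₂ (b₀ , a′)) = proj₁ (D₀D b₀ b) refl
      disjoint (D₀D , D₀D′ , DD′) _ (inj₂ (b₀ , a)) (inj₁ (a₀ , b′)) = proj₁ (D₀D a₀ a) refl
      disjoint (D₀D , D₀D′ , DD′) _ (inj₂ (b₀ , a)) (inj₂ (_ , a′))  = proj₁ (DD′ a a′) refl

      Ds≡ : length Ds ≡ p + suc p
      Ds≡ = suc-injective len

      p<Ds : p < length Ds
      p<Ds = subst (p <_) (sym Ds≡) (m<m+n p (s≤s z≤n))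

      W≤N₁ : ∀ {w} → w ≤ length Ds * support-size → w ≤ N₁
      W≤N₁ {w} w≤ = begin
        w                                     ≤⟨ w≤ ⟩
        length Ds * support-size              ≤⟨ *-monoˡ-≤ support-size (≤-trans (n≤1+n _) (≤-reflexive len)) ⟩
        K * support-size                      ≤⟨ m≤n+m _ _ ⟩
        (M + support-size) + K * support-size ≤⟨ m≤n+m _ (suc L + (suc L * suc L) * M) ⟩
        N₁                                    ∎
        where open ≤-Reasoning

    -- A hole longer than `M` would give a forced edge `xy` for which `addEdge G x y` is good with
    -- parameters `M` and `q`. The induction hypothesis would fill it, and adding `xy` back would
    -- contradict `notFill`.
    no-long-hole : ∀ {u v B C} → Linked G u v (B ∷ C ∷ []) → length B ≤ suc L → length C ≤ suc L →
                   ∀ {k} → Hole (addEdge G u v) k → ¬ M < k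
    no-long-hole lk B≤ C≤ h long =
      let x , y , Ds , _ , _ , lk′ , blocks = relink′ lk B≤ C≤ h long in
      IH (m≤m+n N₀ _) record { local = local′ lk′ blocks ; noLong = no-long-hole′ lk′ blocks }
        (λ F → notFill (fill-add F))

    module _ {k} (h : Hole G k) where
      open Hole h

      k≤ : k ≤ suc L
      k≤ = ≤-pred (≰⇒> (good⇒short good h))

      Bad : List (Fin n) → ℕ × ℕ → Set
      Bad W (a , b) = Chord k a b → ¬ Fill (addEdge G (at a) (at b)) q (_∈ W)

      -- By `notFill`, adding a chord of the hole leaves a graph without a fill-in by `q` edges. As
      -- this graph has no long hole, the induction hypothesis can fail only locally, on a set of
      -- size `M`. Pairs of indices that are not chords satisfy `Bad` vacuously.
      bad-chords : ∀ abs → ¬ ¬ (∃[ W ] length W ≤ length abs * M × All (Bad W) abs)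
      bad-chords []              none = none ([] , z≤n , [])
      bad-chords ((a , b) ∷ abs) none = bad-chords abs λ (W , W≤ , bads) → extend W W≤ bads (chord? k a b)
        where
        extend : ∀ W → length W ≤ length abs * M → All (Bad W) abs → ¬ Dec (Chord k a b)
        extend W W≤ bads (no ¬c) = none (W , ≤-trans W≤ (m≤n+m _ M) , (λ c → ⊥-elim (¬c c)) ∷ bads)
        extend W W≤ bads (yes c) = IH (m≤m+n N₀ _) record
          { local  = λ U U≤ notFill′ → none (U ++ W , ≤-trans (≤-reflexive (length-++ U)) (+-mono-≤ U≤ W≤)
                       , (λ _ F → notFill′ (fill-mono ∈-++⁺ˡ F))
                       ∷ All.map (λ bad c F → bad c (fill-mono (∈-++⁺ʳ U) F)) bads)
          ; noLong = no-long-hole (chord-linked h c) (≤-trans (length-arc h (inner? h a b)) k≤) (≤-trans (length-arc h (outer? h a b)) k≤)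
          } (λ F → notFill (fill-add F))

      -- A fill-in for the hole together with `W` must contain a chord of the hole. Spending this
      -- chord leaves a fill-in by `q` edges on `W`, which `Bad` excludes.
      no-hole : ⊥
      no-hole = bad-chords (cartesianProduct (upTo k) (upTo k)) λ (W , W≤ , bads) →
        local (map at (upTo k) ++ W) (≤-trans (len W W≤) N₁≤N) λ F →
          Fill.holeless F
            (hole-resp h (Fill.H-⊇ F) λ i<j j<k ends e →
              All.lookup bads (∈-cartesianProduct⁺ (∈-upTo⁺ (<-trans (<⇒≤ i<j) j<k)) (∈-upTo⁺ j<k)) (i<j , j<k , ends)
                (fill-mono (∈-++⁺ʳ (map at (upTo k))) (fill-new F e (non i<j j<k ends))))
            (λ i i<k → ∈-++⁺ˡ (∈-map⁺ at (∈-upTo⁺ i<k)))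
        where
        len : ∀ W → length W ≤ length (cartesianProduct (upTo k) (upTo k)) * M → length (map at (upTo k) ++ W) ≤ N₁
        len W W≤ = begin
          length (map at (upTo k) ++ W)            ≡⟨ length-++ (map at (upTo k)) ⟩
          length (map at (upTo k)) + length W      ≤⟨ +-mono-≤ (≤-reflexive (trans (length-map at (upTo k)) (length-upTo k))) W≤ ⟩
          k + length (cartesianProduct (upTo k) (upTo k)) * M
            ≡⟨ cong (λ l → k + l * M) (trans (length-cartesianProduct (upTo k) (upTo k)) (cong₂ _*_ (length-upTo k) (length-upTo k))) ⟩
          k + (k * k) * M                          ≤⟨ +-mono-≤ k≤ (*-monoˡ-≤ M (*-mono-≤ k≤ k≤)) ⟩
          suc L + (suc L * suc L) * M              ≤⟨ m≤m+n _ _ ⟩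
          N₁                                       ∎
          where open ≤-Reasoning

trivial-fill : ∀ {n p} {G : Graph n} → (∀ {k} → ¬ Hole G k) → Fill G p Everywhere
trivial-fill {G = G} no-hole = record
  { H = G ; H-⊇ = λ e → e ; S = [] ; S-≤ = z≤n ; cover = inj₁ ; holeless = λ h _ → no-hole h }

sufficient : ∀ p → ∃ (Sufficient p)
-- Every hole has length at least `4`, that is `2 + holeBound 0`, so a good graph has no hole at
-- all.
sufficient zero    = 0 , λ _ good notFill →
  notFill (trivial-fill λ h → good⇒short good h (Hole.4≤k h))
sufficient (suc q) =
  let N₀ , IH = sufficient q in
  -- The assumption `notFill` rules out all holes, but then `G` is its own fill-in.
  Step.N₁ q N₀ IH , λ N₁≤N good notFill → notFill (trivial-fill (Step.no-hole q N₀ IH N₁≤N good notFill))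

-- Translation to the definitions of the theorem

bool-ext : ∀ {a b} → (a ≡ true → b ≡ true) → (b ≡ true → a ≡ true) → a ≡ b
bool-ext {true}  {b}     f g = sym (f refl)
bool-ext {false} {true}  f g = g refl
bool-ext {false} {false} f g = refl

T⇒≡ : ∀ {b} → IsTrue b → b ≡ true
T⇒≡ {true} _ = refl

≡⇒T : ∀ {b} → b ≡ true → IsTrue b
≡⇒T refl = tt

nextℕ-last : ∀ {k a} → suc a ≡ k → nextℕ k a ≡ 0
nextℕ-last {k} {a} eq rewrite T⇒≡ (≡⇒≡ᵇ (suc a) k eq) = refl

nextℕ-other : ∀ {k a} → suc a ≢ k → nextℕ k a ≡ suc a
nextℕ-other {k} {a} neq with suc a ≡ᵇ k in eq
... | true  = ⊥-elim (neq (≡ᵇ⇒≡ (suc a) k (≡⇒T eq)))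
... | false = refl

CyclicNext : (k a b : ℕ) → Set
CyclicNext k a b = nextℕ k a ≡ b ⊎ nextℕ k b ≡ a

cycAdj⁻ : ∀ k i j → cycAdj k i j ≡ true → CyclicNext k (toℕ i) (toℕ j)
cycAdj⁻ k i j eq with nextℕ k (toℕ i) ≡ᵇ toℕ j in eq₁
... | true  = inj₁ (≡ᵇ⇒≡ (nextℕ k (toℕ i)) (toℕ j) (≡⇒T eq₁))
... | false = inj₂ (≡ᵇ⇒≡ (nextℕ k (toℕ j)) (toℕ i) (≡⇒T eq))

cycAdj⁺ : ∀ k i j → CyclicNext k (toℕ i) (toℕ j) → cycAdj k i j ≡ true
cycAdj⁺ k i j (inj₁ eq) rewrite T⇒≡ (≡⇒≡ᵇ (nextℕ k (toℕ i)) (toℕ j) eq) = refl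
cycAdj⁺ k i j (inj₂ eq) with nextℕ k (toℕ i) ≡ᵇ toℕ j
... | true  = refl
... | false = T⇒≡ (≡⇒≡ᵇ (nextℕ k (toℕ j)) (toℕ i) eq)

module _ {n} {G : Graph n} {k} (h : Hole G k) where
  open Hole h

  private
    next-edge : ∀ {a b} → a < k → nextℕ k a ≡ b → Edge G (at a) (at b)
    next-edge {a} a<k eq with m≤n⇒m<n∨m≡n a<k
    ... | inj₂ last = subst (Edge G (at a)) (cong at (trans (sym (nextℕ-last last)) eq)) (edge-sym G (close last))
    ... | inj₁ lt   = subst (Edge G (at a)) (cong at (trans (sym (nextℕ-other (<⇒≢ lt))) eq)) (next lt)

    edge-next-< : ∀ {a b} → a < b → b < k → Edge G (at a) (at b) → CyclicNext k a b
    edge-next-< {a} {b} a<b b<k e with m≤n⇒m<n∨m≡n a<b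
    ... | inj₂ refl = inj₁ (nextℕ-other (<⇒≢ b<k))
    ... | inj₁ 1+a<b with m≤n⇒m<n∨m≡n b<k
    ...   | inj₁ 1+b<k = ⊥-elim (non 1+a<b b<k (inj₂ 1+b<k) e)
    ...   | inj₂ last with a
    ...     | zero  = inj₂ (nextℕ-last last)
    ...     | suc _ = ⊥-elim (non 1+a<b b<k (inj₁ (s≤s z≤n)) e)

  hole-edge⁺ : ∀ {a b} → a < k → b < k → CyclicNext k a b → Edge G (at a) (at b)
  hole-edge⁺ a<k b<k (inj₁ eq) = next-edge a<k eq
  hole-edge⁺ a<k b<k (inj₂ eq) = edge-sym G (next-edge b<k eq)

  hole-edge⁻ : ∀ {a b} → a < k → b < k → Edge G (at a) (at b) → CyclicNext k a b
  hole-edge⁻ {a} {b} a<k b<k e with <-cmp a b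
  ... | tri< a<b _ _  = edge-next-< a<b b<k e
  ... | tri≈ _ refl _ = ⊥-elim (edge⇒≢ G e refl)
  ... | tri> _ _ b<a  with edge-next-< b<a a<k (edge-sym G e)
  ...   | inj₁ eq = inj₂ eq
  ...   | inj₂ eq = inj₁ eq

  -- The map `f` serves two purposes: it is the identity for a hole of the graph itself, and an
  -- embedding for a hole lying in the image of a smaller graph.
  hole⇒cycle : ∀ {m} {H : Graph m} (f : Fin m → Fin n) (v : Fin k → Fin m) → (∀ i → f (v i) ≡ at (toℕ i)) →
               (∀ {a b} → Edge H a b → Edge G (f a) (f b)) → (∀ {a b} → Edge G (f a) (f b) → Edge H a b) →
               HasInducedCycle H k
  hole⇒cycle {H = H} f v fv to from = v , v-injective , λ i j → bool-ext
    (λ e → cycAdj⁺ k i j (hole-edge⁻ (toℕ<n i) (toℕ<n j) (subst₂ (Edge G) (fv i) (fv j) (to e))))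
    (λ c → from (subst₂ (Edge G) (sym (fv i)) (sym (fv j)) (hole-edge⁺ (toℕ<n i) (toℕ<n j) (cycAdj⁻ k i j c))))
    where
    v-injective : Injective _≡_ _≡_ v
    v-injective {i} {j} eq =
      toℕ-injective (hole-injective h (toℕ<n i) (toℕ<n j) (trans (sym (fv i)) (trans (cong f eq) (fv j))))

module _ {n} {G : Graph n} {k} (4≤k : 4 ≤ k) (cyc : HasInducedCycle G k) where
  private
    v : Fin k → Fin n
    v = proj₁ cyc

    clamp : ℕ → Fin k
    clamp i with i <? k
    ... | yes i<k = fromℕ< i<k
    -- Default value: indices from `k` on are sent to 0, which exists since `4 ≤ k`.
    ... | no _    = fromℕ< (≤-trans (s≤s z≤n) 4≤k)

    toℕ-clamp : ∀ {i} → i < k → toℕ (clamp i) ≡ i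
    toℕ-clamp {i} i<k with i <? k
    ... | yes i<k′ = toℕ-fromℕ< i<k′
    ... | no i≮k   = ⊥-elim (i≮k i<k)

    edge⁺ : ∀ {i j} → i < k → j < k → CyclicNext k i j → Edge G (v (clamp i)) (v (clamp j))
    edge⁺ i<k j<k c = trans (proj₂ (proj₂ cyc) _ _)
      (cycAdj⁺ k _ _ (subst₂ (CyclicNext k) (sym (toℕ-clamp i<k)) (sym (toℕ-clamp j<k)) c))

    edge⁻ : ∀ {i j} → i < k → j < k → Edge G (v (clamp i)) (v (clamp j)) → CyclicNext k i j
    edge⁻ i<k j<k e = subst₂ (CyclicNext k) (toℕ-clamp i<k) (toℕ-clamp j<k)
      (cycAdj⁻ k _ _ (trans (sym (proj₂ (proj₂ cyc) _ _)) e))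

    not-next : ∀ {i j} → suc i < j → j < k → 0 < i ⊎ suc j < k → ¬ CyclicNext k i j
    not-next {i} {j} i<j j<k ends (inj₁ eq) =
      <⇒≢ i<j (trans (sym (nextℕ-other (<⇒≢ (<-trans i<j j<k)))) eq)
    not-next {i} {j} i<j j<k ends (inj₂ eq) with m≤n⇒m<n∨m≡n j<k
    ... | inj₁ 1+j<k = <⇒≢ (<-trans (<⇒≤ i<j) (n<1+n j)) (trans (sym eq) (nextℕ-other (<⇒≢ 1+j<k)))
    ... | inj₂ last  = [ (λ 0<i → <⇒≢ 0<i (trans (sym (nextℕ-last last)) eq)) , (λ lt → <⇒≢ lt last) ]′ ends

  cycle⇒hole : Hole G k
  cycle⇒hole = record
    { at    = λ i → v (clamp i)
    ; 4≤k   = 4≤k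
    ; dis   = λ i<j j<k eq → <⇒≢ i<j (trans (sym (toℕ-clamp (<-trans i<j j<k)))
                (trans (cong toℕ (proj₁ (proj₂ cyc) eq)) (toℕ-clamp j<k)))
    ; next  = λ lt → edge⁺ (<⇒≤ lt) lt (inj₁ (nextℕ-other (<⇒≢ lt)))
    ; close = λ {i} last → edge⁺ (≤-trans (s≤s z≤n) 4≤k) (≤-reflexive last) (inj₂ (nextℕ-last last))
    ; non   = λ i<j j<k ends e → not-next i<j j<k ends (edge⁻ (<-trans (<⇒≤ i<j) j<k) j<k e)
    }

-- Counting added edges

module _ {A B : Set} (c : A → B → Bool) where

  -- This turns the double sum in `addedCount` into the length of the repetition-free list
  -- `addedPairs`.
  length-filter-pairs : ∀ xs ys →
    length (filter (λ (x , y) → c x y ≟ᵇ true) (cartesianProduct xs ys)) ≡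
    sum (map (λ x → sum (map (λ y → if c x y then 1 else 0) ys)) xs)
  length-filter-pairs []       ys = refl
  length-filter-pairs (x ∷ xs) ys =
    trans (cong length (filter-++ (λ (x , y) → c x y ≟ᵇ true) (map (x ,_) ys) (cartesianProduct xs ys)))
      (trans (length-++ (filter (λ (x , y) → c x y ≟ᵇ true) (map (x ,_) ys)))
        (cong₂ _+_ (row ys) (length-filter-pairs xs ys)))
    where
    row : ∀ ys → length (filter (λ (x , y) → c x y ≟ᵇ true) (map (x ,_) ys)) ≡ sum (map (λ y → if c x y then 1 else 0) ys)
    row []       = refl
    row (y ∷ ys) with c x y
    ... | true  = cong suc (row ys)
    ... | false = row ys

module _ {n} (G H : Graph n) where
  private
    new : Fin n → Fin n → Bool
    new i j = (toℕ i <ᵇ toℕ j) ∧ adj H i j ∧ not (adj G i j)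

    new⁻ : ∀ i j → new i j ≡ true → toℕ i < toℕ j × Edge H i j × ¬ Edge G i j
    new⁻ i j eq with toℕ i <ᵇ toℕ j in lt | adj H i j | adj G i j
    ... | true | true | false = <ᵇ⇒< (toℕ i) (toℕ j) (≡⇒T lt) , refl , λ ()

    new⁺ : ∀ i j → toℕ i < toℕ j → Edge H i j → ¬ Edge G i j → new i j ≡ true
    new⁺ i j lt e ¬e rewrite T⇒≡ (<⇒<ᵇ lt) | e with adj G i j
    ... | true  = ⊥-elim (¬e refl)
    ... | false = refl

  addedPairs : List (Fin n × Fin n)
  addedPairs = filter (λ (i , j) → new i j ≟ᵇ true) (cartesianProduct (allFin n) (allFin n))

  length-addedPairs : length addedPairs ≡ addedCount G H
  length-addedPairs = length-filter-pairs new (allFin n) (allFin n)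

  addedPairs-unique : AllPairs _≢_ addedPairs
  addedPairs-unique = filter⁺ (λ (i , j) → new i j ≟ᵇ true) (cartesianProduct⁺ (allFin⁺ n) (allFin⁺ n))

  ∈-addedPairs⁻ : ∀ {i j} → (i , j) ∈ addedPairs → toℕ i < toℕ j × Edge H i j × ¬ Edge G i j
  ∈-addedPairs⁻ {i} {j} ij∈ =
    new⁻ i j (proj₂ (∈-filter⁻ (λ (i , j) → new i j ≟ᵇ true) {xs = cartesianProduct (allFin n) (allFin n)} ij∈))

  ∈-addedPairs⁺ : ∀ {i j} → toℕ i < toℕ j → Edge H i j → ¬ Edge G i j → (i , j) ∈ addedPairs
  ∈-addedPairs⁺ {i} {j} lt e ¬e = ∈-filter⁺ (λ (i , j) → new i j ≟ᵇ true)
    (∈-cartesianProduct⁺ (∈-allFin i) (∈-allFin j)) (new⁺ i j lt e ¬e)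

fill⇒edgeAddChordal : ∀ {n p} {G : Graph n} → Fill G p Everywhere → EdgeAddChordal p G
fill⇒edgeAddChordal {n} {p} {G} F = H , (λ _ _ → H-⊇) ,
  ≤-trans (≤-reflexive (sym (length-addedPairs G H))) (≤-trans (≮⇒≥ few) S-≤) ,
  λ k 4≤k cyc → holeless (cycle⇒hole 4≤k cyc) (λ _ _ → tt)
  where
  open Fill F

  P : Fin n × Fin n → Fin n × Fin n → Set
  P (i , j) s = s ≡ (i , j) ⊎ s ≡ (j , i)

  disjoint : ∀ {ij ij′} → toℕ (proj₁ ij) < toℕ (proj₂ ij) × toℕ (proj₁ ij′) < toℕ (proj₂ ij′) × ij ≢ ij′ →
             ∀ s → P ij s → ¬ P ij′ s
  disjoint (_ , _ , neq)  _ (inj₁ refl) (inj₁ refl) = neq refl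
  disjoint (lt , lt′ , _) _ (inj₁ refl) (inj₂ refl) = <-asym lt lt′
  disjoint (lt , lt′ , _) _ (inj₂ refl) (inj₁ refl) = <-asym lt lt′
  disjoint (_ , _ , neq)  _ (inj₂ refl) (inj₂ refl) = neq refl

  hit : ∀ {ij} → ij ∈ addedPairs G H → ¬ ¬ Any (P ij) S
  hit {i , j} ij∈ none with ∈-addedPairs⁻ G H ij∈
  ... | _ , e , ¬e with cover e
  ...   | inj₁ e′           = ¬e e′
  ...   | inj₂ (inj₁ ij∈S) = none (lose ij∈S (inj₁ refl))
  ...   | inj₂ (inj₂ ji∈S) = none (lose ji∈S (inj₂ refl))

  few : ¬ length S < length (addedPairs G H)
  few = count P (addedPairs G H) S (All.tabulate hit)
    (AllPairs.map disjoint (AllPairs-zip-All (All.tabulate (λ ij∈ → proj₁ (∈-addedPairs⁻ G H ij∈))) (addedPairs-unique G H)))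

pullback : ∀ {m n} → (Fin m → Fin n) → Graph n → Graph m
pullback f G = record
  { adj   = λ i j → adj G (f i) (f j)
  ; sym   = λ i j → adj-sym G (f i) (f j)
  ; irref = λ i → irref G (f i)
  }

module _ {m n p : ℕ} {G : Graph n} {f : Fin m → Fin n} (f-injective : Injective _≡_ _≡_ f) where

  -- `H⁺` adds to `G` the images of the edges of `H`. On the image of `f` it is a copy of `H`, so a
  -- hole there would be a hole of `H`.
  edgeAddChordal⇒fill : EdgeAddChordal p (pullback f G) → Fill G p (λ z → ∃[ a ] f a ≡ z)
  edgeAddChordal⇒fill (H , H-⊇ , H-≤ , H-chordal) = record
    { H        = H⁺
    ; H-⊇      = λ e → fromRel⁺ R? R-sym R-irrefl (inj₁ e)
    ; S        = map (λ (a , b) → f a , f b) (addedPairs (pullback f G) H)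
    ; S-≤      = ≤-trans (≤-reflexive (trans (length-map _ (addedPairs (pullback f G) H)) (length-addedPairs (pullback f G) H))) H-≤
    ; cover    = λ e → cover (fromRel⁻ R? R-sym R-irrefl e)
    ; holeless = λ {k} h inside → H-chordal k (Hole.4≤k h)
        (hole⇒cycle h {H = H} f (λ i → proj₁ (inside (toℕ i) (toℕ<n i))) (λ i → proj₂ (inside (toℕ i) (toℕ<n i)))
          (λ e → fromRel⁺ R? R-sym R-irrefl (inj₂ (_ , _ , refl , refl , e)))
          (λ e → restrict (fromRel⁻ R? R-sym R-irrefl e)))
    }
    where
    R : Fin n → Fin n → Set
    R x y = Edge G x y ⊎ (∃[ a ] ∃[ b ] f a ≡ x × f b ≡ y × Edge H a b)

    R? : ∀ x y → Dec (R x y)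
    R? x y = edge? G x y ⊎-dec any? (λ a → any? (λ b → (f a ≟ x) ×-dec (f b ≟ y) ×-dec edge? H a b))

    R-sym : ∀ {x y} → R x y → R y x
    R-sym (inj₁ e)                        = inj₁ (edge-sym G e)
    R-sym (inj₂ (a , b , fa , fb , e)) = inj₂ (b , a , fb , fa , edge-sym H e)

    R-irrefl : ∀ {x} → ¬ R x x
    R-irrefl (inj₁ e)                        = edge⇒≢ G e refl
    R-irrefl (inj₂ (a , b , fa , fb , e)) = edge⇒≢ H e (f-injective (trans fa (sym fb)))

    H⁺ : Graph n
    H⁺ = fromRel R? R-sym R-irrefl

    restrict : ∀ {a b} → R (f a) (f b) → Edge H a b
    restrict (inj₁ e) = H-⊇ _ _ e
    restrict (inj₂ (_ , _ , fa , fb , e)) = subst₂ (Edge H) (f-injective fa) (f-injective fb) e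

    S : List (Fin n × Fin n)
    S = map (λ (a , b) → f a , f b) (addedPairs (pullback f G) H)

    cover : ∀ {x y} → R x y → Edge G x y ⊎ (x , y) ∈ S ⊎ (y , x) ∈ S
    cover (inj₁ e) = inj₁ e
    cover (inj₂ (a , b , refl , refl , e)) with edge? G (f a) (f b) | <-cmp (toℕ a) (toℕ b)
    ... | yes e′ | _            = inj₁ e′
    ... | no ¬e  | tri< lt _ _  = inj₂ (inj₁ (∈-map⁺ _ (∈-addedPairs⁺ (pullback f G) H lt e ¬e)))
    ... | no ¬e  | tri≈ _ eq _  = ⊥-elim (edge⇒≢ H e (toℕ-injective eq))
    ... | no ¬e  | tri> _ _ gt  = inj₂ (inj₂ (∈-map⁺ _ (∈-addedPairs⁺ (pullback f G) H gt (edge-sym H e) (¬e ∘ edge-sym G))))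

-- Large forbidden graphs are good

unique-lookup-injective : ∀ {A : Set} {xs : List A} → AllPairs _≢_ xs → Injective _≡_ _≡_ (lookup xs)
unique-lookup-injective {xs = _ ∷ _} (_ ∷ _)  {zero}  {zero}  _  = refl
unique-lookup-injective {xs = _ ∷ _} (r ∷ _)  {zero}  {suc j} eq = ⊥-elim (All.lookup r (∈-lookup j) eq)
unique-lookup-injective {xs = _ ∷ _} (r ∷ _)  {suc i} {zero}  eq = ⊥-elim (All.lookup r (∈-lookup i) (sym eq))
unique-lookup-injective {xs = _ ∷ _} (_ ∷ rs) {suc i} {suc j} eq = cong suc (unique-lookup-injective rs eq)

injective⇒surjective : ∀ {n} {f : Fin n → Fin n} → Injective _≡_ _≡_ f → Surjective _≡_ _≡_ f
injective⇒surjective {suc n} {f} inj y with any? (λ x → f x ≟ y)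
... | yes (x , eq) = x , λ { refl → eq }
... | no none = ⊥-elim (<-irrefl refl (injective⇒≤ {f = λ x → punchOut (missed x)}
                  (λ {a} {b} eq → inj (punchOut-injective (missed a) (missed b) eq))))
  where
  missed : ∀ x → y ≢ f x
  missed x eq = none (x , sym eq)

module _ {p n N : ℕ} {F : Graph n} (forbidden : Forbidden (EdgeAddChordal p) F) (notCycle : ¬ IsCycle F)
         (N<n : N < n) (N-big : 2 + holeBound p ≤ N) where
  private
    fill-image : ∀ {m} {f : Fin m → Fin n} → Injective _≡_ _≡_ f → m < n → Fill F p (λ z → ∃[ a ] f a ≡ z)
    fill-image {f = f} inj m<n =
      edgeAddChordal⇒fill inj (proj₂ forbidden (pullback f F) m<n (f , inj , λ _ _ → refl))

  -- At most `N` vertices induce a proper subgraph, which is in the class by minimality. A hole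
  -- longer than `N` either induces a proper subgraph, against `fill⇒no-long-hole`, or spans `F`,
  -- which would then be a cycle.
  large-forbidden⇒good : Good N p F
  large-forbidden⇒good = record { local = λ U U≤N notFill → notFill (local U U≤N) ; noLong = noLong }
    where
    local : ∀ U → length U ≤ N → Fill F p (_∈ U)
    -- `U` may list a vertex several times; removing duplicates makes `lookup` an injection that
    -- describes an induced subgraph.
    local U U≤N = fill-mono (λ z∈ → let z∈′ = ∈-deduplicate⁺ _≟_ z∈ in Any.index z∈′ , sym (Any.lookup-index z∈′))
      (fill-image (unique-lookup-injective (deduplicate-! _≟_ U))
        (≤-<-trans (≤-trans (length-deduplicate _≟_ U) U≤N) N<n))

    noLong : ∀ {k} → Hole F k → ¬ N < k
    noLong {k} h N<k = [ shorter , spanning ]′ (m≤n⇒m<n∨m≡n (injective⇒≤ (proj₁ (proj₂ cycle))))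
      where
      cycle : HasInducedCycle F k
      cycle = hole⇒cycle h {H = F} (λ z → z) (λ i → Hole.at h (toℕ i)) (λ _ → refl) (λ e → e) (λ e → e)

      shorter : ¬ k < n
      shorter k<n = fill⇒no-long-hole p (fill-image (proj₁ (proj₂ cycle)) k<n) h
        (λ i i<k → fromℕ< i<k , cong (Hole.at h) (toℕ-fromℕ< i<k)) (≤-trans N-big (<⇒≤ N<k))

      spanning : k ≢ n
      spanning refl = notCycle (≤-trans (n≤1+n 3) (Hole.4≤k h) , proj₁ cycle
        , (proj₁ (proj₂ cycle) , injective⇒surjective (proj₁ (proj₂ cycle))) , proj₂ (proj₂ cycle))

-- Enumeration of the graphs of bounded order

vectors : ∀ {A : Set} → List A → ∀ n → List (Vec A n)
vectors as zero    = [] ∷ []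
vectors as (suc n) = cartesianProductWith _∷_ as (vectors as n)

∈-vectors : ∀ {A : Set} {as : List A} → (∀ a → a ∈ as) → ∀ {n} (v : Vec A n) → v ∈ vectors as n
∈-vectors all []      = here refl
∈-vectors all (a ∷ v) = ∈-cartesianProductWith⁺ _∷_ (all a) (∈-vectors all v)

matrices : ∀ n → List (Vec (Vec Bool n) n)
matrices n = vectors (vectors (true ∷ false ∷ []) n) n

∈-matrices : ∀ {n} (M : Vec (Vec Bool n) n) → M ∈ matrices n
∈-matrices = ∈-vectors (∈-vectors λ { true → here refl ; false → there (here refl) })

module _ {n} (M : Vec (Vec Bool n) n) where
  private
    R : Fin n → Fin n → Set
    R x y = x ≢ y × (Vec.lookup (Vec.lookup M x) y ≡ true ⊎ Vec.lookup (Vec.lookup M y) x ≡ true)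

    R? : ∀ x y → Dec (R x y)
    R? x y = ¬? (x ≟ y) ×-dec ((_ ≟ᵇ true) ⊎-dec (_ ≟ᵇ true))

    R-sym : ∀ {x y} → R x y → R y x
    R-sym (x≢y , inj₁ e) = ≢-sym x≢y , inj₂ e
    R-sym (x≢y , inj₂ e) = ≢-sym x≢y , inj₁ e

    R-irrefl : ∀ {x} → ¬ R x x
    R-irrefl (x≢x , _) = x≢x refl

  -- An arbitrary Boolean matrix is symmetrised and its diagonal is ignored, so every matrix yields
  -- a graph. The adjacency matrix of a graph yields that graph up to the identity isomorphism.
  fromMatrix : Graph n
  fromMatrix = fromRel R? R-sym R-irrefl

  iso-fromMatrix : (G : Graph n) → (∀ x y → Vec.lookup (Vec.lookup M x) y ≡ adj G x y) → Iso G fromMatrix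
  iso-fromMatrix G eq = (λ x → x) , ((λ p → p) , λ y → y , λ p → p) , λ x y → bool-ext
    (λ e → fromRel⁺ R? R-sym R-irrefl (edge⇒≢ G e , inj₁ (trans (eq x y) e)))
    (λ e → [ (λ e′ → trans (sym (eq x y)) e′) , (λ e′ → edge-sym G (trans (sym (eq y x)) e′)) ]′
             (proj₂ (fromRel⁻ R? R-sym R-irrefl e)))

graphs : ℕ → List (Σ ℕ Graph)
graphs n = map (λ M → n , fromMatrix M) (matrices n)

graphs≤ : ℕ → List (Σ ℕ Graph)
graphs≤ N = concatMap graphs (upTo (suc N))

graphs≤-complete : ∀ {N n} (G : Graph n) → n ≤ N → Any (λ H → Iso G (proj₂ H)) (graphs≤ N)
graphs≤-complete {n = n} G n≤N =
  Any.concatMap⁺ graphs (lose (∈-upTo⁺ (s≤s n≤N)) (Any.map⁺ (lose (∈-matrices M) (iso-fromMatrix M G M-adj))))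
  where
  M : Vec (Vec Bool n) n
  M = Vec.tabulate λ x → Vec.tabulate (adj G x)
  M-adj : ∀ x y → Vec.lookup (Vec.lookup M x) y ≡ adj G x y
  M-adj x y = trans (cong (λ r → Vec.lookup r y) (lookup∘tabulate (λ x → Vec.tabulate (adj G x)) x)) (lookup∘tabulate (adj G x) y)

theorem4p4 : (p : ℕ) → ∃ λ (L : List (Σ ℕ Graph)) → ∀ {n} (F : Graph n) → Forbidden (EdgeAddChordal p) F → ¬ IsCycle F → Any (λ H → Iso F (proj₂ H)) L
theorem4p4 p = graphs≤ N , complete
  where
  N : ℕ
  -- The first summand reaches the threshold of `sufficient`; the second makes holes longer than `N`
  -- impossible in proper induced subgraphs.
  N = proj₁ (sufficient p) + (2 + holeBound p)

  complete : ∀ {n} (F : Graph n) → Forbidden (EdgeAddChordal p) F → ¬ IsCycle F → Any (λ H → Iso F (proj₂ H)) (graphs≤ N)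
  complete {n} F forbidden notCycle with n ≤? N
  ... | yes n≤N = graphs≤-complete F n≤N
  -- Beyond order `N` a forbidden graph that is not a cycle is good, so it would have a fill-in and
  -- belong to the class.
  ... | no n≰N  = ⊥-elim (proj₂ (sufficient p) {G = F} (m≤m+n _ (2 + holeBound p))
                    (large-forbidden⇒good forbidden notCycle (≰⇒> n≰N) (m≤n+m _ (proj₁ (sufficient p))))
                    (λ fill → proj₁ forbidden (fill⇒edgeAddChordal fill)))
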